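{- For all integers $n\geq 0$, $c_{6}(n)\equiv 1 \pmod 2$ if $n=(7j^{2}+5j)/2$ for some $j\in\mathbb{Z}$, and $c_{6}(n)\equiv 0 \pmod 2$ otherwise.
   Context: A partition of $n$ is a finite non-increasing sequence of positive integers (its parts) summing to $n$. Let $c_{6}(n)$ be the number of partitions of $n$ in which either (a) $1$ is the only odd part that may appear (with any multiplicity) and the even parts are distinct, or (b) there is an integer $j\geq1$ such that the even part $2j$ appears exactly twice, every positive even integer less than $2j$ appears exactly twice, every even part larger than $2j$ is at least $4j+2$ and appears at most once, all odd parts are at most $2j+1$, and the odd parts that are at most $2j-1$ are distinct (the part $2j+1$ may appear with any multiplicity). -}

module Defs where

open import Data.Nat using (ℕ; zero; suc; _+_; _*_; _≤ᵇ_; _<ᵇ_; _≡ᵇ_; _∸_)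
open import Data.Nat.Properties using ()
open import Data.Bool using (Bool; true; false; _∧_; _∨_; not; if_then_else_)
open import Data.List using (List; []; _∷_; length; filter; map; concatMap; upTo)
open import Data.Bool.ListAction using (all; any)
open import Data.Nat.Base using (_%_)

-- A partition of n is represented as a non-increasing list of positive
-- integers (its parts) summing to n.

-- partsBounded m n : all non-increasing lists of positive integers,
-- each part ≤ m, summing to n.  (Fuel = n, since every part is ≥ 1.)
partsBounded : ℕ → ℕ → ℕ → List (List ℕ)
partsBounded fuel m zero = [] ∷ []
partsBounded zero m (suc n) = []
partsBounded (suc fuel) m (suc n) =
  concatMap (λ k → map (λ p → suc k ∷ p) (partsBounded fuel (suc k) (suc n ∸ suc k)))
            (filter (λ k → Data.Nat._≤?_ (suc k) m) (upTo (suc n)))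
  where import Data.Nat

partitions : ℕ → List (List ℕ)
partitions n = partsBounded n n n

mult : List ℕ → ℕ → ℕ
mult [] k = 0
mult (x ∷ p) k = if x ≡ᵇ k then suc (mult p k) else mult p k

isEven : ℕ → Bool
isEven x = x % 2 ≡ᵇ 0

condA : List ℕ → Bool
condA p = all (λ x → if isEven x then mult p x ≤ᵇ 1 else x ≡ᵇ 1) p

condBj : List ℕ → ℕ → Bool
condBj p j =
  (mult p (2 * j) ≡ᵇ 2)
  ∧ all (λ i → mult p (2 * suc i) ≡ᵇ 2) (upTo (j ∸ 1))
  ∧ all (λ x → if isEven x
                 then (if 2 * j <ᵇ x then ((4 * j + 2) ≤ᵇ x) ∧ (mult p x ≤ᵇ 1) else true)
                 else ((x ≤ᵇ 2 * j + 1) ∧ (if x ≤ᵇ 2 * j ∸ 1 then mult p x ≤ᵇ 1 else true)))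
        p

-- condition (b): some j ≥ 1 works.  Since the part 2j appears, 2j ≤ n,
-- so j ranges over 1 .. n suffices.
condB : ℕ → List ℕ → Bool
condB n p = any (λ j → condBj p (suc j)) (upTo n)

c6 : ℕ → ℕ
c6 n = length (filter (λ p → Data.Bool._≟_ (condA p ∨ condB n p) true) (partitions n))
  where import Data.Bool

{-# OPTIONS --safe #-}
module Submission where

-- With Q = q², the generating function of c6 is
--   ∑_j Q^(j(j+1)) (−q; q²)_j (−Q^(2j+1); Q)_∞ / (1 − q^(2j+1)),
-- where j = 0 is case (a). Modulo 2 signs do not matter, and 1 − Q^(2j+1) is the square of
-- 1 − q^(2j+1), so this is
--   ∑_j Q^(j(j+1)) (q; q²)_{j+1} (Q^(2j+2); Q)_∞.
-- Substituting the finite identity (q; q²)_{n+1} ≡ ∑_j q^(j(3j+1)/2) [2n+1; n−j]_Q, with j running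
-- over ℤ, and exchanging the sums leaves for each j the Durfee rectangle identity
--   ∑_n Q^(n(n+1)) [2n+1; n−j]_Q (Q^(2n+2); Q)_∞ = Q^(j(j+1)).
-- Hence the series is congruent to ∑_j q^((7j²+5j)/2); this is the third Rogers–Selberg identity
-- modulo 2. All sums and products are truncated, at the price of an error divisible by q^(n+1).

open import Defs
open import Algebra.Bundles using (CommutativeRing)
import Algebra.Properties.CommutativeSemigroup
open import Data.Bool using (Bool; true; false; _xor_; _∧_; _∨_; not; if_then_else_; T)
import Data.Bool as Bool
import Data.Bool.Properties as Bool
open import Data.Bool.ListAction using (all; any; or)
open import Data.List using (List; []; _∷_; _++_; length; filter; concatMap; upTo)
import Data.List as List
import Data.List.Properties as List
open import Data.List.Membership.Propositional using (_∈_; lose)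
open import Data.List.Membership.Propositional.Properties using (∈-upTo⁺)
open import Data.List.Relation.Unary.All using (All; []; _∷_)
import Data.List.Relation.Unary.All as All
import Data.List.Relation.Unary.All.Properties as All
open import Data.List.Relation.Unary.Any using (here; there)
import Data.List.Relation.Unary.Any.Properties as Any
import Data.Maybe as Maybe
open import Data.Nat using (ℕ; zero; suc; s≤s; z≤n; _≤ᵇ_; _<ᵇ_; _≡ᵇ_; _∸_; _≤_; _<_; _%_; _≤?_; _<?_; ⌊_/2⌋)
import Data.Nat as ℕ
import Data.Nat.Properties as ℕ
open import Data.Product using (∃; _,_; proj₁; proj₂; _×_)
open import Data.Sum using (_⊎_; inj₁; inj₂)
open import Data.Unit using (tt)
open import Function using (_∘_; id; Equivalence; mk⇔)
open import Relation.Binary.Definitions using (WeaklyDecidable; tri<; tri≈; tri>)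
open import Relation.Binary.PropositionalEquality as ≡ using (_≡_)
open import Relation.Nullary using (yes; no; ¬_; contradiction)
open import Relation.Nullary.Decidable using (dec-true; dec-false; dec⇒maybe; does-⇔)

open Equivalence using (to; from)

-- The conditions on multiplicities

-- The Durfee rectangle identity has to be used at finite `n`, where its partial sum `S n r` has no
-- product form. It does satisfy a first-order recurrence in `r`, up to multiples of Q^(n(n+1))
-- Q^(n+1). Running it from r = 0 to r = n, where the value is exactly Q^(n(n+1)), and cancelling
-- that power determines `S n 0` modulo Q^(n+1), and then every `S n r`. Only this cancellation
-- needs q to be a non-zero-divisor; the identities before it hold in every commutative ring with 1
-- + 1 = 0. Gaussian binomials enter through relations cleared of denominators, so each identity is
-- a linear combination of such relations with explicit multipliers. The index j over ℤ is folded by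
-- pairing j = r with j = -r-1, which share the coefficient [2n+1; n-r]. The final exponent is
-- j(3j+1)/2 + 2j(j+1) = (7j²+5j)/2. Distinct j give distinct exponents, so no two monomials cancel
-- modulo 2.

data Multiplicity : Set where
  absent once twice free : Multiplicity

isEven-double : ∀ i → isEven (i ℕ.* 2) ≡ true
isEven-double zero = ≡.refl
isEven-double (suc i) = isEven-double i

isEven-1+double : ∀ i → isEven (suc (i ℕ.* 2)) ≡ false
isEven-1+double zero = ≡.refl
isEven-1+double (suc i) = isEven-1+double i

⌊double/2⌋ : ∀ i → ⌊ i ℕ.* 2 /2⌋ ≡ i
⌊double/2⌋ zero = ≡.refl
⌊double/2⌋ (suc i) = ≡.cong suc (⌊double/2⌋ i)

⌊1+double/2⌋ : ∀ i → ⌊ suc (i ℕ.* 2) /2⌋ ≡ i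
⌊1+double/2⌋ zero = ≡.refl
⌊1+double/2⌋ (suc i) = ≡.cong suc (⌊1+double/2⌋ i)

κ-even κ-odd κ : ℕ → ℕ → Multiplicity
κ-even j i = if i ≤ᵇ j then twice else if i ≤ᵇ j ℕ.* 2 then absent else once
κ-odd j i = if i <ᵇ j then once else if i ≤ᵇ j then free else absent
-- How often case (b) with parameter j allows the part k to occur; κ 0 is case (a).
κ j k = if isEven k then κ-even j ⌊ k /2⌋ else κ-odd j ⌊ k /2⌋

κ-double : ∀ j i → κ j (i ℕ.* 2) ≡ κ-even j i
κ-double j i rewrite isEven-double i | ⌊double/2⌋ i = ≡.refl

κ-1+double : ∀ j i → κ j (suc (i ℕ.* 2)) ≡ κ-odd j i
κ-1+double j i rewrite isEven-1+double i | ⌊1+double/2⌋ i = ≡.refl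

m≤m*2 : ∀ m → m ≤ m ℕ.* 2
m≤m*2 m = ℕ.m≤m*n m 2

κ-twice : ∀ {i j} → i ≤ j → κ j (i ℕ.* 2) ≡ twice
κ-twice {i} {j} i≤j rewrite κ-double j i | dec-true (i ≤? j) i≤j = ≡.refl

κ-even-absent : ∀ {i j} → j < i → i ≤ j ℕ.* 2 → κ j (i ℕ.* 2) ≡ absent
κ-even-absent {i} {j} j<i i≤2j
  rewrite κ-double j i | dec-false (i ≤? j) (ℕ.<⇒≱ j<i) | dec-true (i ≤? j ℕ.* 2) i≤2j = ≡.refl

κ-even-once : ∀ j {i} → j ℕ.* 2 < i → κ j (i ℕ.* 2) ≡ once
κ-even-once j {i} 2j<i
  rewrite κ-double j i | dec-false (i ≤? j) (ℕ.<⇒≱ (ℕ.≤-<-trans (m≤m*2 j) 2j<i))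
        | dec-false (i ≤? j ℕ.* 2) (ℕ.<⇒≱ 2j<i) = ≡.refl

κ-odd-once : ∀ {i j} → i < j → κ j (suc (i ℕ.* 2)) ≡ once
κ-odd-once {i} {j} i<j rewrite κ-1+double j i | dec-true (i <? j) i<j = ≡.refl

κ-free : ∀ j → κ j (suc (j ℕ.* 2)) ≡ free
κ-free j rewrite κ-1+double j j | dec-false (j <? j) (ℕ.n≮n j) | dec-true (j ≤? j) ℕ.≤-refl = ≡.refl

κ-odd-absent : ∀ {i j} → j < i → κ j (suc (i ℕ.* 2)) ≡ absent
κ-odd-absent {i} {j} j<i
  rewrite κ-1+double j i | dec-false (i <? j) (ℕ.<⇒≱ (ℕ.m<n⇒m<1+n j<i)) | dec-false (i ≤? j) (ℕ.<⇒≱ j<i) = ≡.refl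

-- A bound for the parts; the truncated products have simple recurrences in n there.
top : ℕ → ℕ
top n = 3 ℕ.+ n ℕ.* 2 ℕ.* 2

allows : Multiplicity → ℕ → Bool
allows absent i = i ≡ᵇ 0
allows once i = i ≤ᵇ 1
allows twice i = i ≡ᵇ 2
allows free i = true

respects : (ℕ → Multiplicity) → ℕ → List ℕ → Bool
respects κ zero p = true
respects κ (suc m) p = respects κ m p ∧ allows (κ (suc m)) (mult p (suc m))

mult-∷-≡ : ∀ x p → mult (x ∷ p) x ≡ suc (mult p x)
mult-∷-≡ x p with x ≡ᵇ x | dec-true (x ℕ.≟ x) ≡.refl
... | true | _ = ≡.refl

mult-∷-≢ : ∀ {x k} p → ¬ x ≡ k → mult (x ∷ p) k ≡ mult p k
mult-∷-≢ {x} {k} p x≢k with x ≡ᵇ k | dec-false (x ℕ.≟ k) x≢k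
... | false | _ = ≡.refl

respects-∷ : ∀ κ {m x} p → m < x → respects κ m (x ∷ p) ≡ respects κ m p
respects-∷ κ {zero} p m<x = ≡.refl
respects-∷ κ {suc m} p m<x = ≡.cong₂ _∧_ (respects-∷ κ p (ℕ.<-trans (ℕ.n<1+n m) m<x))
  (≡.cong (allows (κ (suc m))) (mult-∷-≢ p (ℕ.<⇒≢ m<x ∘ ≡.sym)))

PartsIn : ℕ → List ℕ → Set
PartsIn m = All (λ x → 1 ≤ x × x ≤ m)

partsBounded-PartsIn : ∀ f m n → All (PartsIn m) (partsBounded f m n)
partsBounded-PartsIn f m zero = [] ∷ []
partsBounded-PartsIn zero m (suc n) = []
partsBounded-PartsIn (suc f) m (suc n) =
  All.concat⁺ (All.map⁺ (All.map (λ {k} k<m → All.map⁺ (All.map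
      (λ ps → (s≤s z≤n , k<m) ∷ All.map (λ (1≤x , x≤k) → 1≤x , ℕ.≤-trans x≤k k<m) ps)
      (partsBounded-PartsIn f (suc k) (n ∸ k))))
    (All.all-filter (λ k → suc k ≤? m) (upTo (suc n)))))

partsBounded-fuel : ∀ f g m n → n ≤ f → n ≤ g → partsBounded f m n ≡ partsBounded g m n
partsBounded-fuel f g m zero n≤f n≤g = ≡.refl
partsBounded-fuel (suc f) (suc g) m (suc n) (s≤s n≤f) (s≤s n≤g) =
  List.concatMap-cong (λ k → ≡.cong (List.map (suc k ∷_))
    (partsBounded-fuel f g (suc k) (n ∸ k) (ℕ.≤-trans (ℕ.m∸n≤m n k) n≤f) (ℕ.≤-trans (ℕ.m∸n≤m n k) n≤g)))
    (filter (λ k → suc k ≤? m) (upTo (suc n)))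

mult-above : ∀ {m k p} → PartsIn m p → m < k → mult p k ≡ 0
mult-above [] m<k = ≡.refl
mult-above {p = x ∷ p} ((_ , x≤m) ∷ ps) m<k =
  ≡.trans (mult-∷-≢ p (ℕ.<⇒≢ (ℕ.≤-<-trans x≤m m<k))) (mult-above ps m<k)

≡-from-T : ∀ {a b} → (T a → T b) → (T b → T a) → a ≡ b
≡-from-T {false} {false} f g = ≡.refl
≡-from-T {false} {true} f g = contradiction (g tt) id
≡-from-T {true} {false} f g = contradiction (f tt) id
≡-from-T {true} {true} f g = ≡.refl

respects⁻ : ∀ κ {m} {p} → T (respects κ m p) → ∀ {k} → 1 ≤ k → k ≤ m → T (allows (κ k) (mult p k))
respects⁻ κ {zero} r 1≤k k≤0 = contradiction (ℕ.≤-trans 1≤k k≤0) λ ()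
respects⁻ κ {suc m} {p} r {k} 1≤k k≤m with k ℕ.≟ suc m
... | yes ≡.refl = proj₂ (to Bool.T-∧ r)
... | no k≢ = respects⁻ κ {m} (proj₁ (to (Bool.T-∧ {x = respects κ m p}) r)) 1≤k (ℕ.≤-pred (ℕ.≤∧≢⇒< k≤m k≢))

respects⁺ : ∀ κ m {p} → (∀ k → 1 ≤ k → k ≤ m → T (allows (κ k) (mult p k))) → T (respects κ m p)
respects⁺ κ zero f = tt
respects⁺ κ (suc m) f = from Bool.T-∧
  (respects⁺ κ m (λ k 1≤k k≤m → f k 1≤k (ℕ.m≤n⇒m≤1+n k≤m)) , f (suc m) (s≤s z≤n) ℕ.≤-refl)

data Parity : ℕ → Set where
  even : ∀ i → Parity (i ℕ.* 2)
  odd : ∀ i → Parity (suc (i ℕ.* 2))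

parity : ∀ k → Parity k
parity zero = even 0
parity (suc zero) = odd 0
parity (suc (suc k)) with parity k
... | even i = even (suc i)
... | odd i = odd (suc i)

mult≡0∨∈ : ∀ p k → mult p k ≡ 0 ⊎ k ∈ p
mult≡0∨∈ [] k = inj₁ ≡.refl
mult≡0∨∈ (x ∷ p) k with x ℕ.≟ k | mult≡0∨∈ p k
... | yes ≡.refl | _ = inj₂ (here ≡.refl)
... | no x≢k | inj₁ eq = inj₁ (≡.trans (mult-∷-≢ p x≢k) eq)
... | no x≢k | inj₂ k∈p = inj₂ (there k∈p)

∈⇒mult≢0 : ∀ {p k} → k ∈ p → ∃ λ μ → mult p k ≡ suc μ
∈⇒mult≢0 {x ∷ p} (here ≡.refl) = mult p x , mult-∷-≡ x p
∈⇒mult≢0 {x ∷ p} {k} (there k∈p) with x ≡ᵇ k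
... | true = mult p k , ≡.refl
... | false = ∈⇒mult≢0 k∈p

-- The tests that condA and condBj apply to a part x of multiplicity μ.
testA : ℕ → ℕ → Bool
testA x μ = if isEven x then μ ≤ᵇ 1 else x ≡ᵇ 1

testB : ℕ → ℕ → ℕ → Bool
testB j x μ = if isEven x
  then (if 2 ℕ.* j <ᵇ x then ((4 ℕ.* j ℕ.+ 2) ≤ᵇ x) ∧ (μ ≤ᵇ 1) else true)
  else ((x ≤ᵇ 2 ℕ.* j ℕ.+ 1) ∧ (if x ≤ᵇ 2 ℕ.* j ∸ 1 then μ ≤ᵇ 1 else true))

testA-even : ∀ i μ → testA (suc i ℕ.* 2) μ ≡ allows (κ 0 (suc i ℕ.* 2)) μ
testA-even i μ rewrite κ-even-once 0 {suc i} (s≤s z≤n) | isEven-double i = ≡.refl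

-- Restricted to positive multiplicity: `condA` tests only parts that occur, and for a missing odd
-- part above 1 the two sides differ.
testA-odd : ∀ i μ → testA (suc (i ℕ.* 2)) (suc μ) ≡ allows (κ 0 (suc (i ℕ.* 2))) (suc μ)
testA-odd zero μ = ≡.refl
testA-odd (suc i) μ rewrite κ-odd-absent {suc i} {0} (s≤s z≤n) | isEven-1+double i = ≡.refl

2j<2i : ∀ i j → (2 ℕ.* j <ᵇ i ℕ.* 2) ≡ (j <ᵇ i)
2j<2i i j rewrite ℕ.*-comm 2 j =
  does-⇔ (mk⇔ (ℕ.*-cancelʳ-< 2 j i) (ℕ.*-monoˡ-< 2)) (j ℕ.* 2 <? i ℕ.* 2) (j <? i)

4j+2≤2i : ∀ i j → (4 ℕ.* j ℕ.+ 2 ≤ᵇ i ℕ.* 2) ≡ (j ℕ.* 2 <ᵇ i)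
4j+2≤2i i j rewrite ℕ.+-comm (4 ℕ.* j) 2 | ℕ.*-comm 4 j | ≡.sym (ℕ.*-assoc j 2 2) =
  does-⇔ (mk⇔ (ℕ.*-cancelʳ-≤ (suc (j ℕ.* 2)) i 2) (ℕ.*-monoˡ-≤ 2))
    (suc (j ℕ.* 2) ℕ.* 2 ≤? i ℕ.* 2) (j ℕ.* 2 <? i)

1+2i≤2j+1 : ∀ i j → (suc (i ℕ.* 2) ≤ᵇ 2 ℕ.* j ℕ.+ 1) ≡ (i ≤ᵇ j)
1+2i≤2j+1 i j rewrite ℕ.+-comm (2 ℕ.* j) 1 | ℕ.*-comm 2 j =
  does-⇔ (mk⇔ (ℕ.*-cancelʳ-≤ i j 2 ∘ ℕ.≤-pred) (s≤s ∘ ℕ.*-monoˡ-≤ 2))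
    (suc (i ℕ.* 2) ≤? suc (j ℕ.* 2)) (i ≤? j)

1+2i≤2j-1 : ∀ i j → (suc (i ℕ.* 2) ≤ᵇ 2 ℕ.* suc j ∸ 1) ≡ (i <ᵇ suc j)
1+2i≤2j-1 i j = ≡.trans (≡.cong (λ k → suc (i ℕ.* 2) ≤ᵇ k ∸ 1) (ℕ.*-comm 2 (suc j)))
  (does-⇔ (mk⇔ (s≤s ∘ ℕ.*-cancelʳ-≤ i j 2 ∘ ℕ.≤-pred) (s≤s ∘ ℕ.*-monoˡ-≤ 2 ∘ ℕ.≤-pred))
    (suc (i ℕ.* 2) ≤? suc (j ℕ.* 2)) (i <? suc j))

-- The even parts up to 2j are left to the other two conjuncts of `condBj`, which fix their
-- multiplicity at two.
testB-low : ∀ {i j} μ → i ≤ j → testB j (i ℕ.* 2) μ ≡ true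
testB-low {i} {j} μ i≤j rewrite isEven-double i | 2j<2i i j | dec-false (j <? i) (ℕ.≤⇒≯ i≤j) = ≡.refl

testB-even : ∀ {i j} μ → j < i → testB j (i ℕ.* 2) (suc μ) ≡ allows (κ j (i ℕ.* 2)) (suc μ)
testB-even {i} {j} μ j<i
  rewrite κ-double j i | dec-false (i ≤? j) (ℕ.<⇒≱ j<i) | isEven-double i | 2j<2i i j | dec-true (j <? i) j<i | 4j+2≤2i i j
  with i ≤? j ℕ.* 2
... | yes i≤2j rewrite dec-true (i ≤? j ℕ.* 2) i≤2j | dec-false (j ℕ.* 2 <? i) (ℕ.≤⇒≯ i≤2j) = ≡.refl
... | no i≰2j rewrite dec-false (i ≤? j ℕ.* 2) i≰2j | dec-true (j ℕ.* 2 <? i) (ℕ.≰⇒> i≰2j) = ≡.refl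

testB-odd : ∀ i j μ → testB (suc j) (suc (i ℕ.* 2)) (suc μ) ≡ allows (κ (suc j) (suc (i ℕ.* 2))) (suc μ)
testB-odd i j μ rewrite κ-1+double (suc j) i | isEven-1+double i | 1+2i≤2j+1 i (suc j) | 1+2i≤2j-1 i j
  with i <? suc j | i ≤? suc j
... | yes i<j | _ rewrite dec-true (i <? suc j) i<j | dec-true (i ≤? suc j) (ℕ.<⇒≤ i<j) = ≡.refl
... | no i≮j | yes i≤j rewrite dec-false (i <? suc j) i≮j | dec-true (i ≤? suc j) i≤j = ≡.refl
... | no i≮j | no i≰j rewrite dec-false (i <? suc j) i≮j | dec-false (i ≤? suc j) i≰j = ≡.refl

allows-0 : ∀ {κ} → ¬ κ ≡ twice → T (allows κ 0)
allows-0 {absent} _ = tt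
allows-0 {once} _ = tt
allows-0 {twice} κ≢ = contradiction ≡.refl κ≢
allows-0 {free} _ = tt

κ-high : ∀ {i j} → j < i → ¬ κ j (i ℕ.* 2) ≡ twice
κ-high {i} {j} j<i eq rewrite κ-double j i | dec-false (i ≤? j) (ℕ.<⇒≱ j<i) with i ≤ᵇ j ℕ.* 2 | eq
... | true | ()
... | false | ()

κ-odd≢twice : ∀ i j → ¬ κ j (suc (i ℕ.* 2)) ≡ twice
κ-odd≢twice i j eq rewrite κ-1+double j i with i <ᵇ j | i ≤ᵇ j | eq
... | true | _ | ()
... | false | true | ()
... | false | false | ()

-- A part k with κ k ≠ twice may be missing, so only the parts of p matter.
allows-from-parts : ∀ (κ : ℕ → Multiplicity) (test : ℕ → ℕ → Bool) k {p} → ¬ κ k ≡ twice →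
  (∀ μ → test k (suc μ) ≡ allows (κ k) (suc μ)) →
  All (λ x → T (test x (mult p x))) p → T (allows (κ k) (mult p k))
allows-from-parts κ test k {p} κ≢ eq ts with mult≡0∨∈ p k
... | inj₁ m≡0 rewrite m≡0 = allows-0 κ≢
... | inj₂ k∈p with mult p k | ∈⇒mult≢0 k∈p | All.lookup ts k∈p
...   | _ | μ , ≡.refl | t = ≡.subst T (eq μ) t

parts-from-allows : ∀ (κ : ℕ → Multiplicity) (test : ℕ → ℕ → Bool) k {p} →
  (∀ μ → test k (suc μ) ≡ allows (κ k) (suc μ)) →
  k ∈ p → T (allows (κ k) (mult p k)) → T (test k (mult p k))
parts-from-allows κ test k {p} eq k∈p a with mult p k | ∈⇒mult≢0 k∈p | a
... | _ | μ , ≡.refl | a = ≡.subst T (≡.sym (eq μ)) a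

condA≡respects : ∀ {m p} → PartsIn m p → condA p ≡ respects (κ 0) m p
condA≡respects {m} {p} ps = ≡-from-T
  (λ c → respects⁺ (κ 0) m (λ k → ⇒ (All.all⁺ _ p c) (parity k)))
  (λ r → All.all⁻ _ (All.tabulate (λ {k} k∈p → ⇐ r (parity k) (All.lookup ps k∈p) k∈p)))
  where
  ⇒ : All (λ x → T (testA x (mult p x))) p → ∀ {k} → Parity k → 1 ≤ k → k ≤ m → T (allows (κ 0 k) (mult p k))
  ⇒ ts (even (suc i)) _ _ = allows-from-parts (κ 0) testA (suc i ℕ.* 2) (κ-high {suc i} {0} (s≤s z≤n)) (testA-even i ∘ suc) ts
  ⇒ ts (odd i) _ _ = allows-from-parts (κ 0) testA (suc (i ℕ.* 2)) (κ-odd≢twice i 0) (testA-odd i) ts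
  ⇐ : T (respects (κ 0) m p) → ∀ {k} → Parity k → 1 ≤ k × k ≤ m → k ∈ p → T (testA k (mult p k))
  ⇐ r (even (suc i)) (1≤k , k≤m) k∈p =
    parts-from-allows (κ 0) testA (suc i ℕ.* 2) (testA-even i ∘ suc) k∈p (respects⁻ (κ 0) {m} r 1≤k k≤m)
  ⇐ r (odd i) (1≤k , k≤m) k∈p =
    parts-from-allows (κ 0) testA (suc (i ℕ.* 2)) (testA-odd i) k∈p (respects⁻ (κ 0) {m} r 1≤k k≤m)

-- `respects` looks only at parts up to `m`, so `m` must reach 2(j+1) for it to enforce the double
-- occurrence of that part.
condB≡respects : ∀ {m p} j → suc j ℕ.* 2 ≤ m → PartsIn m p → condBj p (suc j) ≡ respects (κ (suc j)) m p
condB≡respects {m} {p} j 2j≤m ps = ≡-from-T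
  (λ c → respects⁺ (κ (suc j)) m (λ k → let c₁ , c₂₃ = to (Bool.T-∧ {x = mult p (2 ℕ.* suc j) ≡ᵇ 2}) c
                                            c₂ , c₃ = to (Bool.T-∧ {x = all (λ i → mult p (2 ℕ.* suc i) ≡ᵇ 2) (upTo j)}) c₂₃
                                        in ⇒ c₁ c₂ (All.all⁺ _ p c₃) (parity k)))
  (λ r → from Bool.T-∧ (low r j ℕ.≤-refl , from Bool.T-∧
    ( All.all⁻ _ (All.applyUpTo⁺₁ id j (λ {i} i<j → low r i (ℕ.<⇒≤ i<j)))
    , All.all⁻ _ (All.tabulate (λ {k} k∈p → ⇐ r (parity k) (All.lookup ps k∈p) k∈p)))))
  where
  K : ℕ → Multiplicity
  K = κ (suc j)
  ⇒ : T (mult p (2 ℕ.* suc j) ≡ᵇ 2) → T (all (λ i → mult p (2 ℕ.* suc i) ≡ᵇ 2) (upTo j)) →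
      All (λ x → T (testB (suc j) x (mult p x))) p →
      ∀ {k} → Parity k → 1 ≤ k → k ≤ m → T (allows (K k) (mult p k))
  ⇒ c₁ c₂ ts (even (suc i)) _ _ with i ℕ.≟ j | i ≤? j
  ... | yes ≡.refl | _ rewrite κ-twice {suc i} {suc i} ℕ.≤-refl | ℕ.*-comm (suc i) 2 = c₁
  ... | no i≢j | yes i≤j rewrite κ-twice {suc i} {suc j} (s≤s i≤j) | ℕ.*-comm (suc i) 2 =
    All.applyUpTo⁻ id j (All.all⁺ (λ i → mult p (2 ℕ.* suc i) ≡ᵇ 2) (upTo j) c₂) (ℕ.≤∧≢⇒< i≤j i≢j)
  ... | no _ | no i≰j = allows-from-parts K (testB (suc j)) (suc i ℕ.* 2) (κ-high (s≤s (ℕ.≰⇒> i≰j)))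
    (λ μ → testB-even μ (s≤s (ℕ.≰⇒> i≰j))) ts
  ⇒ c₁ c₂ ts (odd i) _ _ = allows-from-parts K (testB (suc j)) (suc (i ℕ.* 2)) (κ-odd≢twice i (suc j)) (testB-odd i j) ts
  low : T (respects K m p) → ∀ i → i ≤ j → T (mult p (2 ℕ.* suc i) ≡ᵇ 2)
  low r i i≤j rewrite ℕ.*-comm 2 (suc i) = ≡.subst (λ M → T (allows M (mult p (suc i ℕ.* 2))))
    (κ-twice {suc i} {suc j} (s≤s i≤j))
    (respects⁻ K {m} r (s≤s z≤n) (ℕ.≤-trans (ℕ.*-monoˡ-≤ 2 (s≤s i≤j)) 2j≤m))
  ⇐ : T (respects K m p) → ∀ {k} → Parity k → 1 ≤ k × k ≤ m → k ∈ p → T (testB (suc j) k (mult p k))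
  ⇐ r (even i) (1≤k , k≤m) k∈p with i ≤? suc j
  ... | yes i≤j = from Bool.T-≡ (testB-low (mult p (i ℕ.* 2)) i≤j)
  ... | no i≰j = parts-from-allows K (testB (suc j)) (i ℕ.* 2) (λ μ → testB-even μ (ℕ.≰⇒> i≰j)) k∈p (respects⁻ K {m} r 1≤k k≤m)
  ⇐ r (odd i) (1≤k , k≤m) k∈p =
    parts-from-allows K (testB (suc j)) (suc (i ℕ.* 2)) (testB-odd i j) k∈p (respects⁻ K {m} r 1≤k k≤m)

allows-twice-once : ∀ {μ} → T (allows twice μ) → T (allows once μ) → μ ≡ 0
allows-twice-once {zero} t o = ≡.refl
allows-twice-once {suc (suc zero)} t ()
allows-twice-once {suc (suc (suc μ))} () o

-- The part 2j separates the two conditions: `κ j` demands two copies of it, while `κ i` with i < j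
-- permits at most one.
κ-exclusive : ∀ {i j m p} → j ℕ.* 2 ≤ m → i < j → T (respects (κ i) m p) → ¬ T (respects (κ j) m p)
κ-exclusive {i} {j} {m} {p} 2j≤m i<j ri rj with mult p (j ℕ.* 2)
  | respects⁻ (κ i) {m} ri (ℕ.≤-trans (ℕ.≤-trans (s≤s z≤n) i<j) (m≤m*2 j)) 2j≤m
  | respects⁻ (κ j) {m} rj (ℕ.≤-trans (ℕ.≤-trans (s≤s z≤n) i<j) (m≤m*2 j)) 2j≤m
... | μ | ai | aj rewrite κ-twice {j} {j} ℕ.≤-refl | κ-double i j | dec-false (j ≤? i) (ℕ.<⇒≱ i<j)
  with j ≤ᵇ i ℕ.* 2
κ-exclusive _ _ _ _ | suc (suc zero) | () | aj | true
κ-exclusive _ _ _ _ | suc (suc zero) | () | aj | false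

κ-unique : ∀ {i j m p} → i ℕ.* 2 ≤ m → j ℕ.* 2 ≤ m →
           T (respects (κ i) m p) → T (respects (κ j) m p) → i ≡ j
κ-unique {i} {j} {m} 2i≤m 2j≤m ri rj with ℕ.<-cmp i j
... | tri< i<j _ _ = contradiction rj (κ-exclusive {m = m} 2j≤m i<j ri)
... | tri≈ _ i≡j _ = i≡j
... | tri> _ _ j<i = contradiction ri (κ-exclusive {m = m} 2i≤m j<i rj)

2i≤top : ∀ {i n} → i ≤ n → i ℕ.* 2 ≤ top n
2i≤top {i} {n} i≤n = ℕ.m≤n⇒m≤o+n 3 (ℕ.≤-trans (ℕ.*-monoˡ-≤ 2 i≤n) (m≤m*2 (n ℕ.* 2)))

-- Sums modulo 2 over lists

bit : Bool → ℕ
bit b = if b then 1 else 0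

isOdd : ℕ → Bool
isOdd zero = false
isOdd (suc n) = not (isOdd n)

%2≡bit-isOdd : ∀ n → n % 2 ≡ bit (isOdd n)
%2≡bit-isOdd zero = ≡.refl
%2≡bit-isOdd (suc zero) = ≡.refl
%2≡bit-isOdd (suc (suc n)) = ≡.trans (%2≡bit-isOdd n) (≡.cong bit (≡.sym (Bool.not-involutive (isOdd n))))

module _ {A : Set} where

  ⨁ : (A → Bool) → List A → Bool
  ⨁ P [] = false
  ⨁ P (x ∷ xs) = P x xor ⨁ P xs

  isOdd-filter : ∀ P xs → isOdd (length (filter (λ x → P x Bool.≟ true) xs)) ≡ ⨁ P xs
  isOdd-filter P [] = ≡.refl
  isOdd-filter P (x ∷ xs) with P x
  ... | true = ≡.cong not (isOdd-filter P xs)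
  ... | false = isOdd-filter P xs

  ⨁-++ : ∀ P xs ys → ⨁ P (xs ++ ys) ≡ ⨁ P xs xor ⨁ P ys
  ⨁-++ P [] ys = ≡.refl
  ⨁-++ P (x ∷ xs) ys = ≡.trans (≡.cong (P x xor_) (⨁-++ P xs ys)) (≡.sym (Bool.xor-assoc (P x) _ _))

  ⨁-cong : ∀ {P P′ xs} → All (λ x → P x ≡ P′ x) xs → ⨁ P xs ≡ ⨁ P′ xs
  ⨁-cong [] = ≡.refl
  ⨁-cong (eq ∷ eqs) = ≡.cong₂ _xor_ eq (⨁-cong eqs)

  ⨁-false : ∀ xs → ⨁ (λ _ → false) xs ≡ false
  ⨁-false [] = ≡.refl
  ⨁-false (x ∷ xs) = ⨁-false xs

⨁-map : ∀ {A B : Set} P (f : A → B) xs → ⨁ P (List.map f xs) ≡ ⨁ (P ∘ f) xs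
⨁-map P f [] = ≡.refl
⨁-map P f (x ∷ xs) = ≡.cong (P (f x) xor_) (⨁-map P f xs)

⨁-concatMap : ∀ {A B : Set} P (f : A → List B) xs → ⨁ P (concatMap f xs) ≡ ⨁ (⨁ P ∘ f) xs
⨁-concatMap P f [] = ≡.refl
⨁-concatMap P f (x ∷ xs) = ≡.trans (⨁-++ P (f x) _) (≡.cong (⨁ P (f x) xor_) (⨁-concatMap P f xs))

⨁-upTo-suc : ∀ P n → ⨁ P (upTo (suc n)) ≡ P 0 xor ⨁ (P ∘ suc) (upTo n)
⨁-upTo-suc P n = ≡.cong (P 0 xor_) (≡.trans
  (≡.cong (⨁ P) (≡.sym (List.map-upTo suc n))) (⨁-map P suc (upTo n)))

-- Raising the bound admits only the index `m`. This isolates the partitions whose largest part is m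
-- + 1.
⨁-below-suc : ∀ P m n → ⨁ (λ k → (k <ᵇ suc m) ∧ P k) (upTo n) ≡
              ⨁ (λ k → (k <ᵇ m) ∧ P k) (upTo n) xor ((m <ᵇ n) ∧ P m)
⨁-below-suc P m zero = ≡.refl
⨁-below-suc P zero (suc n) = begin
  ⨁ (λ k → (k <ᵇ 1) ∧ P k) (upTo (suc n))
    ≡⟨ ⨁-upTo-suc (λ k → (k <ᵇ 1) ∧ P k) n ⟩
  P 0 xor ⨁ (λ k → false) (upTo n)
    ≡⟨ ≡.cong (P 0 xor_) (⨁-false (upTo n)) ⟩
  P 0 xor false
    ≡⟨ Bool.xor-comm (P 0) false ⟩
  P 0
    ≡⟨ ≡.cong (_xor P 0) (≡.sym (⨁-false (upTo (suc n)))) ⟩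
  ⨁ (λ k → false) (upTo (suc n)) xor P 0 ∎
  where open ≡.≡-Reasoning
⨁-below-suc P (suc m) (suc n) = begin
  ⨁ (λ k → (k <ᵇ suc (suc m)) ∧ P k) (upTo (suc n))
    ≡⟨ ⨁-upTo-suc (λ k → (k <ᵇ suc (suc m)) ∧ P k) n ⟩
  P 0 xor ⨁ (λ k → (k <ᵇ suc m) ∧ P (suc k)) (upTo n)
    ≡⟨ ≡.cong (P 0 xor_) (⨁-below-suc (P ∘ suc) m n) ⟩
  P 0 xor (⨁ (λ k → (k <ᵇ m) ∧ P (suc k)) (upTo n) xor ((m <ᵇ n) ∧ P (suc m)))
    ≡⟨ ≡.sym (Bool.xor-assoc (P 0) _ _) ⟩
  (P 0 xor ⨁ (λ k → (k <ᵇ m) ∧ P (suc k)) (upTo n)) xor ((m <ᵇ n) ∧ P (suc m))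
    ≡⟨ ≡.cong (_xor ((m <ᵇ n) ∧ P (suc m))) (≡.sym (⨁-upTo-suc (λ k → (k <ᵇ suc m) ∧ P k) n)) ⟩
  ⨁ (λ k → (k <ᵇ suc m) ∧ P k) (upTo (suc n)) xor ((m <ᵇ n) ∧ P (suc m)) ∎
  where open ≡.≡-Reasoning

⨁-filter-≤ : ∀ P m xs → ⨁ P (filter (λ k → suc k ≤? m) xs) ≡ ⨁ (λ k → (k <ᵇ m) ∧ P k) xs
⨁-filter-≤ P m [] = ≡.refl
⨁-filter-≤ P m (k ∷ xs) with k <ᵇ m
... | true = ≡.cong (P k xor_) (⨁-filter-≤ P m xs)
... | false = ⨁-filter-≤ P m xs

⨁-xor : ∀ {A : Set} (P R : A → Bool) xs → ⨁ (λ x → P x xor R x) xs ≡ ⨁ P xs xor ⨁ R xs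
⨁-xor P R [] = ≡.refl
⨁-xor P R (x ∷ xs) = ≡.trans (≡.cong ((P x xor R x) xor_) (⨁-xor P R xs))
  (interchange (P x) (R x) (⨁ P xs) (⨁ R xs))
  where
  open import Algebra.Properties.CommutativeSemigroup
    (CommutativeRing.+-commutativeSemigroup Bool.xor-∧-commutativeRing)

⨁-swap : ∀ {A B : Set} (f : A → B → Bool) xs ys →
         ⨁ (λ x → ⨁ (f x) ys) xs ≡ ⨁ (λ y → ⨁ (λ x → f x y) xs) ys
⨁-swap f [] ys = ≡.sym (⨁-false ys)
⨁-swap f (x ∷ xs) ys = ≡.trans (≡.cong (⨁ (f x) ys xor_) (⨁-swap f xs ys))
  (≡.sym (⨁-xor (f x) (λ y → ⨁ (λ x → f x y) xs) ys))

⨁-none : ∀ f n → (∀ {i} → i < n → f i ≡ false) → ⨁ f (upTo n) ≡ false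
⨁-none f n none = ≡.trans (⨁-cong (All.applyUpTo⁺₁ id n none)) (⨁-false (upTo n))

any-upTo-suc : ∀ f n → any f (upTo (suc n)) ≡ f 0 ∨ any (f ∘ suc) (upTo n)
any-upTo-suc f n = ≡.cong (λ bs → f 0 ∨ or bs)
  (≡.trans (List.map-applyUpTo suc f n) (≡.sym (List.map-applyUpTo id (f ∘ suc) n)))

-- With at most one witness, existence and parity of the number of witnesses agree. It serves both
-- for the parameter j of case (b) and for the exponents of the theta series.
any≡⨁ : ∀ f n → (∀ {i k} → i < n → k < n → T (f i) → T (f k) → i ≡ k) →
        any f (upTo n) ≡ ⨁ f (upTo n)
any≡⨁ f zero unique = ≡.refl
any≡⨁ f (suc n) unique = ≡.trans (any-upTo-suc f n) (≡.trans
  (first (f 0) ≡.refl) (≡.sym (⨁-upTo-suc f n)))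
  where
  first : ∀ b → f 0 ≡ b → f 0 ∨ any (f ∘ suc) (upTo n) ≡ f 0 xor ⨁ (f ∘ suc) (upTo n)
  first true eq rewrite eq = ≡.sym (≡.cong not (⨁-none (f ∘ suc) n λ {i} i<n →
    Bool.¬-not λ fi≡true →
      ℕ.0≢1+n (unique (s≤s z≤n) (s≤s i<n) (from Bool.T-≡ eq) (from Bool.T-≡ fi≡true))))
  first false eq rewrite eq = any≡⨁ (f ∘ suc) n (λ i<n k<n fi fk →
    ℕ.suc-injective (unique (s≤s i<n) (s≤s k<n) fi fk))

-- Case (a) becomes the index 0 of one family, and mutual exclusion of its members turns the
-- disjunction into a sum modulo 2, which is what generating functions can add up.
condA∨condB≡⨁ : ∀ n {p} → PartsIn (top n) p →
  condA p ∨ condB n p ≡ ⨁ (λ j → respects (κ j) (top n) p) (upTo (suc n))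
condA∨condB≡⨁ n {p} ps = begin
  condA p ∨ condB n p
    ≡⟨ ≡.cong₂ _∨_ (condA≡respects ps) (≡.cong or (List.map-cong-local
         (All.applyUpTo⁺₁ id n (λ {j} j<n → condB≡respects {m = top n} j (2i≤top j<n) ps)))) ⟩
  respects (κ 0) (top n) p ∨ any (λ j → respects (κ (suc j)) (top n) p) (upTo n)
    ≡⟨ ≡.sym (any-upTo-suc (λ j → respects (κ j) (top n) p) n) ⟩
  any (λ j → respects (κ j) (top n) p) (upTo (suc n))
    ≡⟨ any≡⨁ (λ j → respects (κ j) (top n) p) (suc n) (λ i≤n k≤n →
         κ-unique {m = top n} (2i≤top (ℕ.≤-pred i≤n)) (2i≤top (ℕ.≤-pred k≤n))) ⟩
  ⨁ (λ j → respects (κ j) (top n) p) (upTo (suc n)) ∎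
  where open ≡.≡-Reasoning

-- θ r = (7j² + 5j)/2 at j = r, and θ′ r is its value at j = −(r + 1).
θ θ′ : ℕ → ℕ
θ zero = 0
θ (suc r) = 6 ℕ.+ (r ℕ.* 7 ℕ.+ θ r)
θ′ r = 1 ℕ.+ (r ℕ.* 2 ℕ.+ θ r)

-- Rogers–Selberg identities in characteristic 2

module Characteristic2 {ℓ₁ ℓ₂} (R : CommutativeRing ℓ₁ ℓ₂)
  (1+1≈0 : CommutativeRing._≈_ R
             (CommutativeRing._+_ R (CommutativeRing.1# R) (CommutativeRing.1# R))
             (CommutativeRing.0# R)) where

  open CommutativeRing R hiding (zero)
  open import Algebra.Solver.Ring.AlmostCommutativeRing
  open import Algebra.Properties.Ring ring
  open import Relation.Binary.Reasoning.Setoid setoid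

  ⟦_⟧₂ : Bool → Carrier
  ⟦ false ⟧₂ = 0#
  ⟦ true ⟧₂ = 1#

  𝔽₂⟶R : CommutativeRing.rawRing Bool.xor-∧-commutativeRing
           -Raw-AlmostCommutative⟶ fromCommutativeRing R
  𝔽₂⟶R = record
    { ⟦_⟧ = ⟦_⟧₂
    ; +-homo = λ { false y → sym (+-identityˡ _)
                 ; true false → sym (+-identityʳ _)
                 ; true true → sym 1+1≈0 }
    ; *-homo = λ { false y → sym (zeroˡ _) ; true y → sym (*-identityˡ _) }
    ; -‿homo = λ { false → sym -0#≈0# ; true → +-inverseˡ-unique 1# 1# 1+1≈0 }
    ; 0-homo = refl
    ; 1-homo = refl
    }

  _≟₂_ : WeaklyDecidable (Induced-equivalence 𝔽₂⟶R)
  x ≟₂ y = Maybe.map (λ { ≡.refl → refl }) (dec⇒maybe (x Bool.≟ y))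

  -- With coefficients in 𝔽₂, the solver knows that the characteristic is 2.
  open import Algebra.Solver.Ring
    (CommutativeRing.rawRing Bool.xor-∧-commutativeRing) (fromCommutativeRing R) 𝔽₂⟶R _≟₂_
    public using (solve; _:=_; _:+_; _:*_; con; Polynomial)

  :1 : ∀ {n} → Polynomial n
  :1 = con true

  -- Reduces a consequence of known relations to a pure ring identity: nested calls, with the `k` as
  -- multipliers, form a linear combination of the relations.
  by-hypothesis : ∀ k {l r x y} → l ≈ r → x + k * l ≈ y + k * r → x ≈ y
  by-hypothesis k {l} {r} {x} {y} l≈r eq =
    +-cancelʳ (k * r) x y (trans (+-congˡ (*-congˡ (sym l≈r))) eq)

  ∑ : ℕ → (ℕ → Carrier) → Carrier
  ∑ zero f = 0#
  ∑ (suc n) f = ∑ n f + f n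

  ∑-cong-< : ∀ n {f g} → (∀ {i} → i < n → f i ≈ g i) → ∑ n f ≈ ∑ n g
  ∑-cong-< zero f≈g = refl
  ∑-cong-< (suc n) f≈g = +-cong (∑-cong-< n (λ i<n → f≈g (ℕ.m<n⇒m<1+n i<n))) (f≈g (ℕ.n<1+n n))

  ∑-cong : ∀ n {f g} → (∀ i → f i ≈ g i) → ∑ n f ≈ ∑ n g
  ∑-cong n f≈g = ∑-cong-< n (λ {i} _ → f≈g i)

  ∑-distrib-+ : ∀ n f g → ∑ n (λ i → f i + g i) ≈ ∑ n f + ∑ n g
  ∑-distrib-+ zero f g = sym (+-identityˡ 0#)
  ∑-distrib-+ (suc n) f g = trans (+-congʳ (∑-distrib-+ n f g))
    (solve 4 (λ a b c d → (a :+ b) :+ (c :+ d) := (a :+ c) :+ (b :+ d)) refl _ _ _ _)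

  *-distribˡ-∑ : ∀ n k f → ∑ n (λ i → k * f i) ≈ k * ∑ n f
  *-distribˡ-∑ zero k f = sym (zeroʳ k)
  *-distribˡ-∑ (suc n) k f = trans (+-congʳ (*-distribˡ-∑ n k f)) (sym (distribˡ k _ _))

module RogersSelberg {ℓ₁ ℓ₂} (R : CommutativeRing ℓ₁ ℓ₂)
  (1+1≈0 : CommutativeRing._≈_ R
             (CommutativeRing._+_ R (CommutativeRing.1# R) (CommutativeRing.1# R))
             (CommutativeRing.0# R))
  (q : CommutativeRing.Carrier R) where

  open CommutativeRing R hiding (zero)
  open Characteristic2 R 1+1≈0
  open import Algebra.Properties.CommutativeSemiring.Exp commutativeSemiring using (_^_; ^-distrib-*; ^-homo-*; ^-assocʳ)
  open import Relation.Binary.Reasoning.Setoid setoid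

  Q : Carrier
  Q = q * q

  -- Gaussian binomial coefficients with a central lower index

  -- With [m; k] (zero for k < 0) the Gaussian binomial coefficient in base Q,
  -- u n r = [2n; n − r] and w n r = [2n + 1; n − r].
  u w : ℕ → ℕ → Carrier
  u zero zero = 1#
  u zero (suc r) = 0#
  u (suc n) zero = w n 0 + Q * Q ^ n * w n 0
  u (suc n) (suc r) = w n r + Q * Q * Q ^ n * Q ^ r * w n (suc r)
  w n r = u n r + Q * Q ^ n * Q ^ r * u n (suc r)

  -- Quotients of neighbouring coefficients, such as (1 - Q^(n+r+1)) [2n; n-r-1] = (1 - Q^(n-r))
  -- [2n; n-r], multiplied by Q^r to avoid negative exponents. Pascal's rule derives each from the
  -- others at the same or the previous level, hence the joint induction on `n`.
  u-ratio : ∀ n r → Q ^ r * (1# + Q * Q ^ n * Q ^ r) * u n (suc r) ≈ (Q ^ r + Q ^ n) * u n r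
  w-ratio : ∀ n r → Q ^ r * (1# + Q * Q * Q ^ n * Q ^ r) * w n (suc r) ≈ (Q ^ r + Q ^ n) * w n r
  w-u : ∀ n r → Q ^ r * (1# + Q * Q * Q ^ n * Q ^ n) * w n r ≈ (Q ^ r + Q * Q ^ n) * u (suc n) r

  -- The factor 1 - Q^(n-r) at r = n appears here as 1 + 1, which is zero.
  u-ratio zero zero =
    solve 1 (λ z → :1 :* (:1 :+ z :* :1 :* :1) :* con false := (:1 :+ :1) :* :1) refl Q
  u-ratio zero (suc r) =
    solve 2 (λ z y → y :* (:1 :+ z :* :1 :* y) :* con false := (y :+ :1) :* con false)
      refl Q (Q ^ suc r)
  u-ratio (suc n) r =
    by-hypothesis 1# (w-u n r) (by-hypothesis (Q * Q * Q ^ n * Q ^ r) (w-ratio n r)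
    (solve 6 (λ z x y s t p →
      y :* (:1 :+ z :* (z :* x) :* y) :* (s :+ z :* z :* x :* y :* t)
        :+ :1 :* (y :* (:1 :+ z :* z :* x :* x) :* s)
        :+ z :* z :* x :* y :* (y :* (:1 :+ z :* z :* x :* y) :* t)
      := (y :+ z :* x) :* p
        :+ :1 :* ((y :+ z :* x) :* p)
        :+ z :* z :* x :* y :* ((y :+ x) :* s))
      refl Q (Q ^ n) (Q ^ r) (w n r) (w n (suc r)) (u (suc n) r)))
  w-ratio n r =
    by-hypothesis 1# (u-ratio n r) (by-hypothesis (Q * Q ^ n * Q ^ r) (u-ratio n (suc r))
    (solve 6 (λ z x y s t v →
      y :* (:1 :+ z :* z :* x :* y) :* (t :+ z :* x :* (z :* y) :* v)
        :+ :1 :* (y :* (:1 :+ z :* x :* y) :* t)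
        :+ z :* x :* y :* (z :* y :* (:1 :+ z :* x :* (z :* y)) :* v)
      := (y :+ x) :* (s :+ z :* x :* y :* t)
        :+ :1 :* ((y :+ x) :* s)
        :+ z :* x :* y :* ((z :* y :+ x) :* t))
      refl Q (Q ^ n) (Q ^ r) (u n r) (u n (suc r)) (u n (suc (suc r)))))
  w-u n zero =
    solve 3 (λ z x s →
      :1 :* (:1 :+ z :* z :* x :* x) :* s := (:1 :+ z :* x) :* (s :+ z :* x :* s))
      refl Q (Q ^ n) (w n 0)
  w-u n (suc r) =
    by-hypothesis Q (w-ratio n r)
    (solve 5 (λ z x y s t →
      z :* y :* (:1 :+ z :* z :* x :* x) :* t
        :+ z :* (y :* (:1 :+ z :* z :* x :* y) :* t)
      := (z :* y :+ z :* x) :* (s :+ z :* z :* x :* y :* t)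
        :+ z :* ((y :+ x) :* s))
      refl Q (Q ^ n) (Q ^ r) (w n r) (w n (suc r)))

  -- The rule (1 - Q^(m-k)) [m; k] = (1 - Q^m) [m-1; k] at m = 2n+1 and k = n-r; `w-u-suc` is its
  -- instance m = 2n+2.
  u-w : ∀ n r → (1# + Q * Q ^ n * Q ^ r) * w n r ≈ (1# + Q * Q ^ n * Q ^ n) * u n r
  u-w n r =
    by-hypothesis (Q * Q ^ n) (u-ratio n r)
    (solve 5 (λ z x y s t →
      (:1 :+ z :* x :* y) :* (s :+ z :* x :* y :* t)
        :+ z :* x :* (y :* (:1 :+ z :* x :* y) :* t)
      := (:1 :+ z :* x :* x) :* s
        :+ z :* x :* ((y :+ x) :* s))
      refl Q (Q ^ n) (Q ^ r) (u n r) (u n (suc r)))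

  w-u-suc : ∀ n r → (1# + Q * Q * Q ^ n * Q ^ r) * u (suc n) (suc r) ≈
                    (1# + Q * Q * Q ^ n * Q ^ n) * w n r
  w-u-suc n r =
    by-hypothesis (Q * Q * Q ^ n) (w-ratio n r)
    (solve 5 (λ z x y s t →
      (:1 :+ z :* z :* x :* y) :* (s :+ z :* z :* x :* y :* t)
        :+ z :* z :* x :* (y :* (:1 :+ z :* z :* x :* y) :* t)
      := (:1 :+ z :* z :* x :* x) :* s
        :+ z :* z :* x :* ((y :+ x) :* s))
      refl Q (Q ^ n) (Q ^ r) (w n r) (w n (suc r)))

  k*0≈0 : ∀ k {x} → x ≈ 0# → k * x ≈ 0#
  k*0≈0 k x≈0 = trans (*-congˡ x≈0) (zeroʳ k)

  x+k*0≈x : ∀ x k {y} → y ≈ 0# → x + k * y ≈ x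
  x+k*0≈x x k y≈0 = trans (+-congˡ (k*0≈0 k y≈0)) (+-identityʳ x)

  u-zero : ∀ {n r} → n ℕ.< r → u n r ≈ 0#
  w-zero : ∀ {n r} → n ℕ.< r → w n r ≈ 0#
  u-zero {zero} {suc r} n<r = refl
  u-zero {suc n} {suc r} (s≤s n<r) =
    trans (x+k*0≈x _ _ (w-zero (ℕ.m<n⇒m<1+n n<r))) (w-zero n<r)
  w-zero {n} {r} n<r = trans (x+k*0≈x _ _ (u-zero (ℕ.m<n⇒m<1+n n<r))) (u-zero n<r)

  u-diagonal : ∀ n → u n n ≈ 1#
  w-diagonal : ∀ n → w n n ≈ 1#
  u-diagonal zero = refl
  u-diagonal (suc n) = trans (x+k*0≈x _ _ (w-zero (ℕ.n<1+n n))) (w-diagonal n)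
  w-diagonal n = trans (x+k*0≈x _ _ (u-zero (ℕ.n<1+n n))) (u-diagonal n)

  -- The finite theta expansion of (q; q²)_n

  -- a r = q^(r(3r+1)/2) and b r = q^(3r(r+1)/2).
  a b c : ℕ → Carrier
  a zero = 1#
  a (suc r) = b r * (Q * Q ^ r)
  b zero = 1#
  b (suc r) = a r * (q * Q * Q ^ r * Q ^ r)
  c r = a r + a r * (q * Q ^ r)

  -- (q; q²)_n.
  O : ℕ → Carrier
  O zero = 1#
  O (suc n) = O n * (1# + q * Q ^ n)

  -- Sums over j in ℤ of q^(j(3j+1)/2) times [2n+1; n-j] or [2n; n-j]. The index j = -r-1 has
  -- exponent r(3r+1)/2 + 2r + 1, and by symmetry its coefficient is [2n+1; n-r] or [2n; n-r-1].
  w-sum u-sum : ℕ → ℕ → Carrier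
  w-sum n m = ∑ m (λ r → c r * w n r)
  u-sum n m = ∑ m (λ r → a r * u n r + a r * (q * Q ^ r) * u n (suc r))

  -- True summand by summand: the difference of the two sides is `a r * q` times the relation
  -- `u-ratio n r`.
  w-sum≈u-sum : ∀ n m → w-sum n m ≈ (1# + q * Q ^ n) * u-sum n m
  w-sum≈u-sum n m = trans
    (∑-cong m (λ r → by-hypothesis (a r * q) (u-ratio n r)
      (solve 6 (λ q x y s t e →
        (e :+ e :* (q :* y)) :* (s :+ q :* q :* x :* y :* t)
          :+ e :* q :* (y :* (:1 :+ q :* q :* x :* y) :* t)
        := (:1 :+ q :* x) :* (e :* s :+ e :* (q :* y) :* t)
          :+ e :* q :* ((y :+ x) :* s))
        refl q (Q ^ n) (Q ^ r) (u n r) (u n (suc r)) (a r))))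
    (*-distribˡ-∑ m _ _)

  y : ℕ → ℕ → Carrier
  y n r = Q * Q ^ n * b r * w n r

  -- Pascal's two rules produce y n (m − 1) + y n (m + 1) from the m-th summand; modulo 2
  -- these terms telescope.
  u-sum-suc : ∀ n m → u-sum (suc n) (suc m) ≈ w-sum n (suc m) + (y n m + y n (suc m))
  u-sum-suc n zero =
    solve 5 (λ q z x s t →
      con false :+ (:1 :* (s :+ z :* x :* s) :+ :1 :* (q :* :1) :* (s :+ z :* z :* x :* :1 :* t))
      := con false :+ (:1 :+ :1 :* (q :* :1)) :* s
        :+ (z :* x :* :1 :* s :+ z :* x :* (:1 :* (q :* z :* :1 :* :1)) :* t))
      refl q Q (Q ^ n) (w n 0) (w n 1)
  u-sum-suc n (suc m) = trans (+-congʳ (u-sum-suc n m))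
    (by-hypothesis (b m * Q) (w-ratio n m)
    (solve 10 (λ q z x y s t v e f A →
      A :+ (z :* x :* f :* s :+ z :* x :* (e :* (q :* z :* y :* y)) :* t)
        :+ (f :* (z :* y) :* (s :+ z :* z :* x :* y :* t)
           :+ f :* (z :* y) :* (q :* (z :* y)) :* (t :+ z :* z :* x :* (z :* y) :* v))
        :+ f :* z :* (y :* (:1 :+ z :* z :* x :* y) :* t)
      := A :+ (f :* (z :* y) :+ f :* (z :* y) :* (q :* (z :* y))) :* t
        :+ (z :* x :* (e :* (q :* z :* y :* y)) :* t
           :+ z :* x :* (f :* (z :* y) :* (q :* z :* (z :* y) :* (z :* y))) :* v)
        :+ f :* z :* ((y :+ x) :* s))
      refl q Q (Q ^ n) (Q ^ m) (w n m) (w n (suc m)) (w n (suc (suc m))) (a m) (b m)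
        (w-sum n (suc m))))

  y-zero : ∀ {n r} → n ℕ.< r → y n r ≈ 0#
  y-zero n<r = k*0≈0 _ (w-zero n<r)

  -- Passing from upper index 2n to 2n+1 contributes the factor 1 + q^(2n+1), and passing from 2n+1
  -- to 2n+2 changes nothing once the boundary terms vanish. The condition n < m makes the sums
  -- complete.
  u-sum≈O : ∀ {n m} → n ℕ.< m → u-sum n m ≈ O n
  u-sum≈O {zero} {suc zero} _ =
    solve 1 (λ q → con false :+ (:1 :* :1 :+ :1 :* (q :* :1) :* con false) := :1) refl q
  u-sum≈O {zero} {suc (suc m)} _ = trans
    (+-cong (u-sum≈O {zero} {suc m} (s≤s z≤n)) (+-cong (zeroʳ _) (zeroʳ _)))
    (solve 0 (:1 :+ (con false :+ con false) := :1) refl)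
  u-sum≈O {suc n} {suc m} (s≤s n<m) = begin
    u-sum (suc n) (suc m)
      ≈⟨ u-sum-suc n m ⟩
    w-sum n (suc m) + (y n m + y n (suc m))
      ≈⟨ +-cong (w-sum≈u-sum n (suc m)) (+-cong (y-zero n<m) (y-zero (ℕ.m<n⇒m<1+n n<m))) ⟩
    (1# + q * Q ^ n) * u-sum n (suc m) + (0# + 0#)
      ≈⟨ +-congʳ (*-congˡ (u-sum≈O (ℕ.m<n⇒m<1+n n<m))) ⟩
    (1# + q * Q ^ n) * O n + (0# + 0#)
      ≈⟨ solve 2 (λ x y → x :* y :+ (con false :+ con false) := y :* x) refl _ _ ⟩
    O (suc n) ∎

  w-sum≈O : ∀ {n m} → n ℕ.< m → w-sum n m ≈ O (suc n)
  w-sum≈O {n} {m} n<m = begin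
    w-sum n m                    ≈⟨ w-sum≈u-sum n m ⟩
    (1# + q * Q ^ n) * u-sum n m ≈⟨ *-congˡ (u-sum≈O n<m) ⟩
    (1# + q * Q ^ n) * O n       ≈⟨ *-comm _ _ ⟩
    O (suc n)                    ∎

  -- The Durfee rectangle identity at finite level

  -- d r = Q^(r(r+1)).
  d : ℕ → Carrier
  d zero = 1#
  d (suc r) = d r * (Q * Q * Q ^ r * Q ^ r)

  E : ℕ → Carrier
  E n = (1# + Q * Q * Q ^ n * Q ^ n) * (1# + Q * Q * Q * Q ^ n * Q ^ n)

  -- S n r = ∑_{m ≤ n} Q^(m(m+1)) [2m + 1; m − r] ∏_{2m+2 ≤ i ≤ 2n+1} (1 + Q^i). As n → ∞ the
  -- Durfee rectangle identity makes this d r; at finite n, S-suc is its telescoped form.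
  S : ℕ → ℕ → Carrier
  S zero r = w zero r
  S (suc n) r = E n * S n r + d (suc n) * w (suc n) r

  -- What the induction in `S-suc` needs after d n Q^(n+1) is factored out. One factor of `E n`
  -- trades upper index 2n+1 for 2n+2, the other trades 2n+2 for 2n+3, and `w-ratio` closes the gap.
  S-step : ∀ n r → E n * (Q * Q ^ r * (w n r + w n (suc r))) + Q * Q * Q ^ r * Q ^ r * (Q * Q ^ n * w (suc n) r)
    ≈ Q * Q ^ n * w (suc n) (suc r) + Q * Q * Q * Q ^ n * Q ^ n * (Q * Q ^ r * (w (suc n) r + w (suc n) (suc r)))
  S-step n r =
    by-hypothesis (Q * Q ^ r * (1# + Q * Q * Q * Q ^ n * Q ^ n)) (w-u-suc n r)
    (by-hypothesis (1# + Q * Q * Q * Q ^ n * Q ^ n) (w-u n (suc r))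
    (by-hypothesis (Q * Q ^ r * (1# + Q * Q * Q ^ n * Q ^ r) + (Q * Q ^ r + Q * Q ^ n)) (u-w (suc n) (suc r))
    (by-hypothesis (Q * Q * Q * Q ^ n * Q ^ r) (w-ratio (suc n) r)
    (solve 8 (λ z x y s t p f g →
      let E₁ = :1 :+ z :* z :* x :* x ; E₂ = :1 :+ z :* z :* z :* x :* x
          k₃ = z :* y :* (:1 :+ z :* z :* x :* y) :+ (z :* y :+ z :* x)
          k₄ = z :* z :* z :* x :* y in
      E₁ :* E₂ :* (z :* y :* (s :+ t)) :+ z :* z :* y :* y :* (z :* x :* f)
        :+ z :* y :* E₂ :* ((:1 :+ z :* z :* x :* y) :* p)
        :+ E₂ :* (z :* y :* E₁ :* t)
        :+ k₃ :* ((:1 :+ z :* (z :* x) :* (z :* y)) :* g)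
        :+ k₄ :* (y :* (:1 :+ z :* z :* (z :* x) :* y) :* g)
      := z :* x :* g :+ z :* z :* z :* x :* x :* (z :* y :* (f :+ g))
        :+ z :* y :* E₂ :* (E₁ :* s)
        :+ E₂ :* ((z :* y :+ z :* x) :* p)
        :+ k₃ :* ((:1 :+ z :* (z :* x) :* (z :* x)) :* p)
        :+ k₄ :* ((y :+ z :* x) :* f))
      refl Q (Q ^ n) (Q ^ r) (w n r) (w n (suc r)) (u (suc n) (suc r)) (w (suc n) r) (w (suc n) (suc r))))))

  -- Apart from the correction, this is the recurrence of `d` in `r`. The correction carries the
  -- factor d n Q^(n+1), one Q^(n+1) more than the `d n` cancelled in `S-0`.
  S-suc : ∀ n r → S n (suc r) + d n * (Q * Q ^ n) * (Q * Q ^ r * (w n r + w n (suc r)))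
                  ≈ Q * Q * Q ^ r * Q ^ r * S n r
  S-suc zero zero =
    solve 1 (λ z →
      con false :+ z :* :1 :* (z :* :1) :* con false
        :+ :1 :* (z :* :1) :* (z :* :1 :* (:1 :+ z :* :1 :* :1 :* con false
             :+ (con false :+ z :* :1 :* (z :* :1) :* con false)))
      := z :* z :* :1 :* :1 :* (:1 :+ z :* :1 :* :1 :* con false))
      refl Q
  S-suc zero (suc r) =
    solve 2 (λ z y →
      con false :+ z :* :1 :* (z :* y) :* con false
        :+ :1 :* (z :* :1) :* (z :* y :* (con false :+ z :* :1 :* y :* con false
             :+ (con false :+ z :* :1 :* (z :* y) :* con false)))
      := z :* z :* y :* y :* (con false :+ z :* :1 :* y :* con false))
      refl Q (Q ^ suc r)
  S-suc (suc n) r =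
    by-hypothesis (E n) (S-suc n r) (by-hypothesis (d n * (Q * Q ^ n)) (S-step n r)
    (solve 11 (λ z x y s t f g k D S₀ S₁ →
      k :* S₁ :+ D :* (z :* z :* x :* x) :* g
        :+ D :* (z :* z :* x :* x) :* (z :* (z :* x)) :* (z :* y :* (f :+ g))
        :+ k :* (S₁ :+ D :* (z :* x) :* (z :* y :* (s :+ t)))
        :+ D :* (z :* x) :* (k :* (z :* y :* (s :+ t)) :+ z :* z :* y :* y :* (z :* x :* f))
      := z :* z :* y :* y :* (k :* S₀ :+ D :* (z :* z :* x :* x) :* f)
        :+ k :* (z :* z :* y :* y :* S₀)
        :+ D :* (z :* x) :* (z :* x :* g :+ z :* z :* z :* x :* x :* (z :* y :* (f :+ g))))
      refl Q (Q ^ n) (Q ^ r) (w n r) (w n (suc r)) (w (suc n) r) (w (suc n) (suc r))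
        (E n) (d n) (S n r) (S n (suc r))))

  S-from-0 : ∀ n r → ∃ λ e → S n r ≈ d r * S n 0 + d n * (Q * Q ^ n) * e
  S-from-0 n zero = 0# , solve 2 (λ s k → s := :1 :* s :+ k :* con false) refl _ _
  S-from-0 n (suc r) with S-from-0 n r
  ... | e , eq = Q * Q * Q ^ r * Q ^ r * e + Q * Q ^ r * (w n r + w n (suc r)) ,
    by-hypothesis 1# (S-suc n r) (by-hypothesis (Q * Q * Q ^ r * Q ^ r) eq
    (solve 8 (λ l k D S₀ S₁ S₂ e m →
      S₂ :+ :1 :* (S₂ :+ k :* m) :+ l :* S₁
      := D :* l :* S₀ :+ k :* (l :* e :+ m) :+ :1 :* (l :* S₁) :+ l :* (D :* S₀ :+ k :* e))
      refl (Q * Q * Q ^ r * Q ^ r) (d n * (Q * Q ^ n)) (d r) (S n 0) (S n r) (S n (suc r)) e (Q * Q ^ r * (w n r + w n (suc r)))))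

  S-zero : ∀ {n r} → n ℕ.< r → S n r ≈ 0#
  S-zero {zero} n<r = w-zero n<r
  S-zero {suc n} n<r =
    trans (x+k*0≈x _ _ (w-zero n<r)) (k*0≈0 _ (S-zero (ℕ.<-trans (ℕ.n<1+n n) n<r)))

  -- At r = n only the summand m = n survives, since [2m+1; m-n] vanishes for m < n.
  S-diagonal : ∀ n → S n n ≈ d n
  S-diagonal zero = w-diagonal 0
  S-diagonal (suc n) = trans
    (+-cong (k*0≈0 _ (S-zero (ℕ.n<1+n n))) (trans (*-congˡ (w-diagonal (suc n))) (*-identityʳ _)))
    (+-identityˡ _)

  -- L n = ∑_{j ≤ n} d j (q; q²)_{j+1} ∏_{2j+2 ≤ i ≤ 2n+1} (1 + Q^i).
  L : ℕ → Carrier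
  L zero = O 1
  L (suc n) = E n * L n + d (suc n) * O (suc (suc n))

  -- The exchange of summations, by induction: both sides obey the same recurrence in `n`, and each
  -- new term is an instance of the finite theta expansion.
  L≈∑S : ∀ {n m} → n ℕ.< m → L n ≈ ∑ m (λ r → c r * S n r)
  L≈∑S {zero} n<m = sym (w-sum≈O n<m)
  L≈∑S {suc n} {m} n<m = sym (begin
    ∑ m (λ r → c r * (E n * S n r + d (suc n) * w (suc n) r))
      ≈⟨ ∑-cong m (λ r → solve 5 (λ c e s d w →
           c :* (e :* s :+ d :* w) := e :* (c :* s) :+ d :* (c :* w)) refl _ _ _ _ _) ⟩
    ∑ m (λ r → E n * (c r * S n r) + d (suc n) * (c r * w (suc n) r))
      ≈⟨ ∑-distrib-+ m _ _ ⟩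
    ∑ m (λ r → E n * (c r * S n r)) + ∑ m (λ r → d (suc n) * (c r * w (suc n) r))
      ≈⟨ +-cong (*-distribˡ-∑ m _ _) (*-distribˡ-∑ m _ _) ⟩
    E n * ∑ m (λ r → c r * S n r) + d (suc n) * w-sum (suc n) m
      ≈⟨ +-cong (*-congˡ (sym (L≈∑S (ℕ.<-trans (ℕ.n<1+n n) n<m)))) (*-congˡ (w-sum≈O n<m)) ⟩
    L (suc n) ∎)

  Q^≈ : ∀ r → Q ^ r ≈ q ^ r * q ^ r
  Q^≈ r = ^-distrib-* q q r

  a*q^≈b : ∀ r → a r * q ^ r ≈ b r
  a*q^≈b zero = *-identityˡ 1#
  a*q^≈b (suc r) = by-hypothesis (q * Q * Q ^ r * q ^ r) (a*q^≈b r) (by-hypothesis (a r * q * Q * Q ^ r) (Q^≈ r)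
    (solve 6 (λ q z x y a b →
      b :* (z :* y) :* (q :* x) :+ q :* z :* y :* x :* (a :* x) :+ a :* q :* z :* y :* y
      := a :* (q :* z :* y :* y) :+ q :* z :* y :* x :* b :+ a :* q :* z :* y :* (x :* x))
      refl q Q (q ^ r) (Q ^ r) (a r) (b r)))

  -- The exponent grows by 7r + 6 at each step: r from replacing `a r` by `b r`, 2r + 2 from `b r`
  -- to `a (suc r)`, and 4r + 4 from `d`.
  a*d≈q^θ : ∀ r → a r * d r ≈ q ^ θ r
  a*d≈q^θ zero = *-identityˡ 1#
  a*d≈q^θ (suc r) = begin
    b r * (Q * Q ^ r) * (d r * (Q * Q * Q ^ r * Q ^ r))
      ≈⟨ *-cong (*-cong (sym (a*q^≈b r)) (*-congˡ (Q^≈ r))) (*-congˡ (*-cong (*-congˡ (Q^≈ r)) (Q^≈ r))) ⟩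
    a r * q ^ r * (Q * (q ^ r * q ^ r)) * (d r * (Q * Q * (q ^ r * q ^ r) * (q ^ r * q ^ r)))
      ≈⟨ solve 4 (λ q x a d →
           a :* x :* (q :* q :* (x :* x)) :* (d :* (q :* q :* (q :* q) :* (x :* x) :* (x :* x)))
           := q :* (q :* (q :* (q :* (q :* (q :* (x :* (x :* (x :* (x :* (x :* (x :* (x :* :1)))))) :* (a :* d))))))))
           refl q (q ^ r) (a r) (d r) ⟩
    q⁶* ((q ^ r) ^ 7 * (a r * d r))
      ≈⟨ cong6 (trans (*-cong (^-assocʳ q r 7) (a*d≈q^θ r)) (sym (^-homo-* q (r ℕ.* 7) (θ r)))) ⟩
    q ^ θ (suc r) ∎
    where
    q⁶*_ : Carrier → Carrier
    q⁶* x = q * (q * (q * (q * (q * (q * x)))))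
    cong6 : ∀ {x y} → x ≈ y → q⁶* x ≈ q⁶* y
    cong6 eq = *-congˡ (*-congˡ (*-congˡ (*-congˡ (*-congˡ (*-congˡ eq)))))

  c*d≈ : ∀ r → c r * d r ≈ q ^ θ r + q ^ θ′ r
  c*d≈ r = begin
    (a r + a r * (q * Q ^ r)) * d r
      ≈⟨ *-congʳ (+-congˡ (*-congˡ (*-congˡ (Q^≈ r)))) ⟩
    (a r + a r * (q * (q ^ r * q ^ r))) * d r
      ≈⟨ solve 4 (λ q x a d → (a :+ a :* (q :* (x :* x))) :* d := a :* d :+ q :* (x :* (x :* :1) :* (a :* d)))
           refl q (q ^ r) (a r) (d r) ⟩
    a r * d r + q * ((q ^ r) ^ 2 * (a r * d r))
      ≈⟨ +-cong (a*d≈q^θ r) (*-congˡ (trans (*-cong (^-assocʳ q r 2) (a*d≈q^θ r)) (sym (^-homo-* q (r ℕ.* 2) (θ r))))) ⟩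
    q ^ θ r + q ^ θ′ r ∎

  -- Removing the correction terms by cancellation

  module _ (q-cancel : ∀ {x y} → q * x ≈ q * y → x ≈ y) where

    Q-cancel : ∀ {x y} → Q * x ≈ Q * y → x ≈ y
    Q-cancel eq = q-cancel (q-cancel (trans (sym (*-assoc q q _)) (trans eq (*-assoc q q _))))

    Q^-cancel : ∀ n {x y} → Q ^ n * x ≈ Q ^ n * y → x ≈ y
    Q^-cancel zero eq = trans (sym (*-identityˡ _)) (trans eq (*-identityˡ _))
    Q^-cancel (suc n) eq =
      Q^-cancel n (Q-cancel (trans (sym (*-assoc _ _ _)) (trans eq (*-assoc _ _ _))))

    d-cancel : ∀ n {x y} → d n * x ≈ d n * y → x ≈ y
    d-cancel zero eq = trans (sym (*-identityˡ _)) (trans eq (*-identityˡ _))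
    d-cancel (suc n) eq = Q^-cancel n (Q^-cancel n (Q-cancel (Q-cancel (d-cancel n
      (trans (sym (shuffle _)) (trans eq (shuffle _)))))))
      where
      shuffle : ∀ x → d (suc n) * x ≈ d n * (Q * (Q * (Q ^ n * (Q ^ n * x))))
      shuffle x = solve 4 (λ d z y x → d :* (z :* z :* y :* y) :* x := d :* (z :* (z :* (y :* (y :* x)))))
        refl (d n) Q (Q ^ n) x

    -- Comparing the two values of `S n n`, from the recurrence and from the diagonal, gives d n = d
    -- n (S n 0 + Q^(n+1) e), and `d n` cancels.
    S-0 : ∀ n → ∃ λ e → S n 0 ≈ 1# + Q * Q ^ n * e
    S-0 n with S-from-0 n n
    ... | e , eq = e , by-hypothesis 1# S₀ (solve 2 (λ s k → s :+ :1 :* (s :+ k) := :1 :+ k :+ :1 :* :1) refl _ _)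
      where
      S₀ : S n 0 + Q * Q ^ n * e ≈ 1#
      S₀ = d-cancel n (begin
        d n * (S n 0 + Q * Q ^ n * e)
          ≈⟨ trans (distribˡ _ _ _) (+-congˡ (sym (*-assoc _ _ _))) ⟩
        d n * S n 0 + d n * (Q * Q ^ n) * e
          ≈⟨ trans (sym eq) (S-diagonal n) ⟩
        d n
          ≈⟨ sym (*-identityʳ _) ⟩
        d n * 1# ∎)

    S≈d : ∀ n r → ∃ λ e → S n r ≈ d r + Q * Q ^ n * e
    S≈d n r with S-from-0 n r | S-0 n
    ... | e , eq | f , eq₀ = d r * f + d n * e , (begin
      S n r
        ≈⟨ eq ⟩
      d r * S n 0 + d n * (Q * Q ^ n) * e
        ≈⟨ +-congʳ (*-congˡ eq₀) ⟩
      d r * (1# + Q * Q ^ n * f) + d n * (Q * Q ^ n) * e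
        ≈⟨ solve 5 (λ d D k e f → d :* (:1 :+ k :* f) :+ D :* k :* e := d :+ k :* (d :* f :+ D :* e))
             refl _ _ _ _ _ ⟩
      d r + Q * Q ^ n * (d r * f + d n * e) ∎)

    L-theta : ∀ n → ∃ λ x → L n ≈ ∑ (suc n) (λ r → q ^ θ r + q ^ θ′ r) + Q * Q ^ n * x
    L-theta n = ∑ (suc n) (λ r → c r * proj₁ (S≈d n r)) , (begin
      L n
        ≈⟨ L≈∑S (ℕ.n<1+n n) ⟩
      ∑ (suc n) (λ r → c r * S n r)
        ≈⟨ ∑-cong (suc n) (λ r → trans (*-congˡ (proj₂ (S≈d n r))) (trans
             (solve 4 (λ c d k x → c :* (d :+ k :* x) := c :* d :+ k :* (c :* x)) refl _ _ _ _)
             (+-congʳ (c*d≈ r)))) ⟩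
      ∑ (suc n) (λ r → q ^ θ r + q ^ θ′ r + Q * Q ^ n * (c r * proj₁ (S≈d n r)))
        ≈⟨ trans (∑-distrib-+ (suc n) _ _) (+-congˡ (*-distribˡ-∑ (suc n) _ _)) ⟩
      _ ∎)

  q^double : ∀ i → q ^ (i ℕ.* 2) ≈ Q ^ i
  q^double i = trans (sym (^-assocʳ q i 2)) (trans
    (solve 1 (λ x → x :* (x :* :1) := x :* x) refl (q ^ i)) (sym (Q^≈ i)))

  Q^double : ∀ n → Q ^ (n ℕ.* 2) ≈ Q ^ n * Q ^ n
  Q^double n = trans (sym (^-assocʳ Q n 2)) (solve 1 (λ x → x :* (x :* :1) := x :* x) refl (Q ^ n))

  -- The product for each parameter j

  -- F m is the generating function ∏_{1 ≤ k ≤ m} ∑_i q^(k i), where i runs over the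
  -- multiplicities that κ allows for k.
  record IsProduct (κ : ℕ → Multiplicity) (F : ℕ → Carrier) : Set ℓ₂ where
    field
      F-0 : F 0 ≈ 1#
      F-absent : ∀ m → κ (suc m) ≡.≡ absent → F (suc m) ≈ F m
      F-once : ∀ m → κ (suc m) ≡.≡ once → F (suc m) ≈ F m + q ^ suc m * F m
      F-twice : ∀ m → κ (suc m) ≡.≡ twice → F (suc m) ≈ q ^ suc m * (q ^ suc m * F m)
      F-free : ∀ m → κ (suc m) ≡.≡ free → F (suc m) ≈ F m + q ^ suc m * F (suc m)

  module _ (F : ℕ → ℕ → Carrier) (isProduct : ∀ j → IsProduct (κ j) (F j)) where

    open module Product j = IsProduct (isProduct j)

    -- Two copies each of 2, 4, ..., 2i give q^(4(1+...+i)) = Q^(i(i+1)), and the distinct odd parts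
    -- below 2i give `O i`.
    F-2i : ∀ {i j} → i ≤ j → F j (i ℕ.* 2) ≈ d i * O i
    F-2i {zero} {j} i≤j = trans (F-0 j) (sym (*-identityˡ 1#))
    F-2i {suc i} {j} i<j = begin
      F j (suc i ℕ.* 2)
        ≈⟨ F-twice j (suc (i ℕ.* 2)) (κ-twice i<j) ⟩
      q ^ (suc i ℕ.* 2) * (q ^ (suc i ℕ.* 2) * F j (suc (i ℕ.* 2)))
        ≈⟨ *-cong (q^double (suc i)) (*-cong (q^double (suc i)) (F-once j (i ℕ.* 2) (κ-odd-once i<j))) ⟩
      Q * Q ^ i * (Q * Q ^ i * (F j (i ℕ.* 2) + q * q ^ (i ℕ.* 2) * F j (i ℕ.* 2)))
        ≈⟨ *-congˡ (*-congˡ (+-cong (F-2i (ℕ.<⇒≤ i<j)) (*-cong (*-congˡ (q^double i)) (F-2i (ℕ.<⇒≤ i<j))))) ⟩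
      Q * Q ^ i * (Q * Q ^ i * (d i * O i + q * Q ^ i * (d i * O i)))
        ≈⟨ solve 5 (λ q z x d o → z :* x :* (z :* x :* (d :* o :+ q :* x :* (d :* o)))
             := d :* (z :* z :* x :* x) :* (o :* (:1 :+ q :* x))) refl q Q (Q ^ i) (d i) (O i) ⟩
      d (suc i) * O (suc i) ∎

    F-1+2j : ∀ j → F j (suc (j ℕ.* 2)) ≈ d j * O j + q * Q ^ j * F j (suc (j ℕ.* 2))
    F-1+2j j = trans (F-free j (j ℕ.* 2) (κ-free j))
      (+-cong (F-2i ℕ.≤-refl) (*-congʳ (*-congˡ (q^double j))))

    -- None of the parts 2j+2, ..., 4j+1 is allowed; each step of `i` passes one even and one odd
    -- part of this gap.
    F-gap : ∀ {i j} → i ≤ j → F j (suc ((i ℕ.+ j) ℕ.* 2)) ≈ F j (suc (j ℕ.* 2))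
    F-gap {zero} i≤j = refl
    F-gap {suc i} {j} i<j = trans
      (F-absent j ((suc i ℕ.+ j) ℕ.* 2) (κ-odd-absent (s≤s (ℕ.m≤n+m j i))))
      (trans (F-absent j (suc ((i ℕ.+ j) ℕ.* 2)) (κ-even-absent (s≤s (ℕ.m≤n+m j i))
        (≡.subst (suc i ℕ.+ j ≤_) j+j≡j*2 (ℕ.+-monoˡ-≤ j i<j)))) (F-gap (ℕ.<⇒≤ i<j)))
      where
      j+j≡j*2 : j ℕ.+ j ≡.≡ j ℕ.* 2
      j+j≡j*2 = ≡.trans (≡.cong (j ℕ.+_) (≡.sym (ℕ.+-identityʳ j))) (ℕ.*-comm 2 j)

    -- Modulo 2, the factor 1 + q^(4j+2) turns 1/(1 − q^(2j+1)) into 1 + q^(2j+1).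
    F-top-diagonal : ∀ j → F j (top j) ≈ d j * O (suc j)
    F-top-diagonal j = begin
      F j (top j)
        ≈⟨ F-absent j (suc (j ℕ.* 2) ℕ.* 2) (κ-odd-absent (s≤s (m≤m*2 j))) ⟩
      F j (suc (j ℕ.* 2) ℕ.* 2)
        ≈⟨ F-once j (suc (j ℕ.* 2 ℕ.* 2)) (κ-even-once j ℕ.≤-refl) ⟩
      F j (suc (j ℕ.* 2 ℕ.* 2)) + q ^ (suc (j ℕ.* 2) ℕ.* 2) * F j (suc (j ℕ.* 2 ℕ.* 2))
        ≈⟨ +-cong gap (*-cong (trans (q^double (suc (j ℕ.* 2))) (*-congˡ (Q^double j))) gap) ⟩
      F j (suc (j ℕ.* 2)) + Q * (Q ^ j * Q ^ j) * F j (suc (j ℕ.* 2))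
        ≈⟨ by-hypothesis (1# + q * Q ^ j) (F-1+2j j)
             (solve 5 (λ q x f d o →
               f :+ q :* q :* (x :* x) :* f :+ (:1 :+ q :* x) :* f
               := d :* (o :* (:1 :+ q :* x)) :+ (:1 :+ q :* x) :* (d :* o :+ q :* x :* f))
               refl q (Q ^ j) (F j (suc (j ℕ.* 2))) (d j) (O j)) ⟩
      d j * O (suc j) ∎
      where
      gap : F j (suc (j ℕ.* 2 ℕ.* 2)) ≈ F j (suc (j ℕ.* 2))
      gap = ≡.subst (λ i → F j (suc (i ℕ.* 2)) ≈ F j (suc (j ℕ.* 2)))
        (≡.trans (≡.cong (j ℕ.+_) (≡.sym (ℕ.+-identityʳ j))) (ℕ.*-comm 2 j)) (F-gap {j} ℕ.≤-refl)

    -- Between 4n+3 and 4n+7 only 4n+4 and 4n+6 may occur, each at most once; these are the two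
    -- factors of `E n`.
    F-top-suc : ∀ {j n} → j ≤ n → F j (top (suc n)) ≈ E n * F j (top n)
    F-top-suc {j} {n} j≤n = begin
      F j (7 ℕ.+ n ℕ.* 2 ℕ.* 2)
        ≈⟨ F-absent j ((3 ℕ.+ n ℕ.* 2) ℕ.* 2) (κ-odd-absent (s≤s (ℕ.m≤n⇒m≤o+n 2 j≤2n))) ⟩
      F j (6 ℕ.+ n ℕ.* 2 ℕ.* 2)
        ≈⟨ F-once j (5 ℕ.+ n ℕ.* 2 ℕ.* 2) (κ-even-once j (s≤s (ℕ.m≤n⇒m≤o+n 2 2j≤2n))) ⟩
      F j (5 ℕ.+ n ℕ.* 2 ℕ.* 2) + q ^ ((3 ℕ.+ n ℕ.* 2) ℕ.* 2) * F j (5 ℕ.+ n ℕ.* 2 ℕ.* 2)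
        ≈⟨ +-cong step (*-cong (trans (q^double (3 ℕ.+ n ℕ.* 2)) (*-congˡ (*-congˡ (*-congˡ (Q^double n))))) step) ⟩
      f + k * f + Q * (Q * (Q * (Q ^ n * Q ^ n))) * (f + k * f)
        ≈⟨ solve 3 (λ z x f →
             let k = z :* (z :* (x :* x)) in
             f :+ k :* f :+ z :* (z :* (z :* (x :* x))) :* (f :+ k :* f)
             := (:1 :+ z :* z :* x :* x) :* (:1 :+ z :* z :* z :* x :* x) :* f) refl Q (Q ^ n) f ⟩
      E n * F j (top n) ∎
      where
      f k : Carrier
      f = F j (top n)
      k = Q * (Q * (Q ^ n * Q ^ n))
      2j≤2n : j ℕ.* 2 ≤ n ℕ.* 2
      2j≤2n = ℕ.*-monoˡ-≤ 2 j≤n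
      j≤2n : j ≤ n ℕ.* 2
      j≤2n = ℕ.≤-trans j≤n (m≤m*2 n)
      step : F j (5 ℕ.+ n ℕ.* 2 ℕ.* 2) ≈ f + k * f
      step = trans
        (F-absent j ((2 ℕ.+ n ℕ.* 2) ℕ.* 2) (κ-odd-absent (s≤s (ℕ.m≤n⇒m≤o+n 1 j≤2n))))
        (trans (F-once j (3 ℕ.+ n ℕ.* 2 ℕ.* 2) (κ-even-once j (s≤s (ℕ.m≤n⇒m≤o+n 1 2j≤2n))))
          (+-congˡ (*-congʳ (trans (q^double (2 ℕ.+ n ℕ.* 2)) (*-congˡ (*-congˡ (Q^double n)))))))

    ∑F≈L : ∀ n → ∑ (suc n) (λ j → F j (top n)) ≈ L n
    ∑F≈L zero = trans (+-identityˡ _) (trans (F-top-diagonal 0) (*-identityˡ _))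
    ∑F≈L (suc n) = +-cong
      (trans (∑-cong-< (suc n) (λ { (s≤s j≤n) → F-top-suc j≤n }))
        (trans (*-distribˡ-∑ (suc n) _ _) (*-congˡ (∑F≈L n))))
      (F-top-diagonal (suc n))

    -- Since Q^(n+1) = q^(n+1) q^(n+1), one factor q^(n+1) suffices to hide the error from the
    -- coefficient of q^n; the other goes into the witness.
    theta : (∀ {x y} → q * x ≈ q * y → x ≈ y) → ∀ n →
            ∃ λ x → ∑ (suc n) (λ j → F j (top n)) ≈ ∑ (suc n) (λ r → q ^ θ r + q ^ θ′ r) + q ^ suc n * x
    theta q-cancel n = let x , eq = L-theta q-cancel n in q ^ suc n * x , (begin
      ∑ (suc n) (λ j → F j (top n))
        ≈⟨ trans (∑F≈L n) eq ⟩
      ∑ (suc n) (λ r → q ^ θ r + q ^ θ′ r) + Q * Q ^ n * x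
        ≈⟨ +-congˡ (*-congʳ (*-congˡ (Q^≈ n))) ⟩
      ∑ (suc n) (λ r → q ^ θ r + q ^ θ′ r) + Q * (q ^ n * q ^ n) * x
        ≈⟨ +-congˡ (solve 3 (λ q y x → q :* q :* (y :* y) :* x := q :* y :* (q :* y :* x)) refl q (q ^ n) x) ⟩
      ∑ (suc n) (λ r → q ^ θ r + q ^ θ′ r) + q ^ suc n * (q ^ suc n * x) ∎)

-- Formal power series

module PowerSeries {ℓ₁ ℓ₂} (K : CommutativeRing ℓ₁ ℓ₂) where

  open CommutativeRing K hiding (zero)
  open Algebra.Properties.CommutativeSemigroup +-commutativeSemigroup using (x∙yz≈y∙xz; interchange)
  open import Relation.Binary.Reasoning.Setoid setoid

  Series : Set ℓ₁
  Series = ℕ → Carrier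

  infix 4 _≋_
  -- Wrapped in a record so that the two series can be inferred from the type of an equality.
  record _≋_ (f g : Series) : Set ℓ₂ where
    constructor coefficientwise
    field at : ∀ n → f n ≈ g n
  open _≋_ public

  infixl 6 _⊕_
  infixl 7 _⊛_

  -- The Cauchy product, following f = f 0 + X (f ∘ suc); this avoids sums over pairs of indices.
  _⊕_ _⊛_ : Series → Series → Series
  (f ⊕ g) n = f n + g n
  (f ⊛ g) zero = f 0 * g 0
  (f ⊛ g) (suc n) = f 0 * g (suc n) + (f ∘ suc ⊛ g) n

  ⊖_ : Series → Series
  (⊖ f) n = - f n

  𝟘 𝟙 X : Series
  𝟘 n = 0#
  𝟙 zero = 1#
  𝟙 (suc n) = 0#
  X zero = 0#
  X (suc n) = 𝟙 n

  ⊛-cong : ∀ {f f′ g g′} → (∀ n → f n ≈ f′ n) → (∀ n → g n ≈ g′ n) →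
           ∀ n → (f ⊛ g) n ≈ (f′ ⊛ g′) n
  ⊛-cong f≈ g≈ zero = *-cong (f≈ 0) (g≈ 0)
  ⊛-cong f≈ g≈ (suc n) = +-cong (*-cong (f≈ 0) (g≈ (suc n))) (⊛-cong (f≈ ∘ suc) g≈ n)

  ⊛-distribʳ : ∀ h f g n → ((f ⊕ g) ⊛ h) n ≈ (f ⊛ h) n + (g ⊛ h) n
  ⊛-distribʳ h f g zero = distribʳ _ _ _
  ⊛-distribʳ h f g (suc n) =
    trans (+-cong (distribʳ _ _ _) (⊛-distribʳ h (f ∘ suc) (g ∘ suc) n)) (interchange _ _ _ _)

  ⊛-scale : ∀ k f g n → ((λ i → k * f i) ⊛ g) n ≈ k * (f ⊛ g) n
  ⊛-scale k f g zero = *-assoc _ _ _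
  ⊛-scale k f g (suc n) =
    trans (+-cong (*-assoc _ _ _) (⊛-scale k (f ∘ suc) g n)) (sym (distribˡ _ _ _))

  -- The defining recursion mirrored to the right factor, from which commutativity follows by
  -- induction.
  ⊛-suc : ∀ f g n → (f ⊛ g) (suc n) ≈ f (suc n) * g 0 + (f ⊛ (g ∘ suc)) n
  ⊛-suc f g zero = +-comm _ _
  ⊛-suc f g (suc n) = trans (+-congˡ (⊛-suc (f ∘ suc) g n)) (x∙yz≈y∙xz _ _ _)

  ⊛-comm : ∀ f g n → (f ⊛ g) n ≈ (g ⊛ f) n
  ⊛-comm f g zero = *-comm _ _
  ⊛-comm f g (suc n) =
    trans (+-cong (*-comm _ _) (⊛-comm (f ∘ suc) g n)) (sym (⊛-suc g f n))

  ⊛-assoc : ∀ f g h n → ((f ⊛ g) ⊛ h) n ≈ (f ⊛ (g ⊛ h)) n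
  ⊛-assoc f g h zero = *-assoc _ _ _
  ⊛-assoc f g h (suc n) = begin
    f 0 * g 0 * h (suc n) + (((λ i → f 0 * g (suc i)) ⊕ (f ∘ suc ⊛ g)) ⊛ h) n
      ≈⟨ +-cong (*-assoc _ _ _) (⊛-distribʳ h _ _ n) ⟩
    f 0 * (g 0 * h (suc n)) + (((λ i → f 0 * g (suc i)) ⊛ h) n + ((f ∘ suc ⊛ g) ⊛ h) n)
      ≈⟨ +-congˡ (+-cong (⊛-scale (f 0) (g ∘ suc) h n) (⊛-assoc (f ∘ suc) g h n)) ⟩
    f 0 * (g 0 * h (suc n)) + (f 0 * (g ∘ suc ⊛ h) n + (f ∘ suc ⊛ (g ⊛ h)) n)
      ≈⟨ trans (sym (+-assoc _ _ _)) (+-congʳ (sym (distribˡ _ _ _))) ⟩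
    f 0 * (g ⊛ h) (suc n) + (f ∘ suc ⊛ (g ⊛ h)) n ∎

  𝟘-⊛ : ∀ f n → (𝟘 ⊛ f) n ≈ 0#
  𝟘-⊛ f zero = zeroˡ _
  𝟘-⊛ f (suc n) = trans (+-cong (zeroˡ _) (𝟘-⊛ f n)) (+-identityˡ _)

  𝟙-⊛ : ∀ f n → (𝟙 ⊛ f) n ≈ f n
  𝟙-⊛ f zero = *-identityˡ _
  𝟙-⊛ f (suc n) = trans (+-cong (*-identityˡ _) (𝟘-⊛ f n)) (+-identityʳ _)

  X-⊛-suc : ∀ f n → (X ⊛ f) (suc n) ≈ f n
  X-⊛-suc f n = trans (+-cong (zeroˡ _) (𝟙-⊛ f n)) (+-identityˡ _)

  X-cancel : ∀ {f g} → X ⊛ f ≋ X ⊛ g → f ≋ g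
  X-cancel {f} {g} eq .at n = trans (sym (X-⊛-suc f n)) (trans (eq .at (suc n)) (X-⊛-suc g n))

  ⊛-⊕-commutativeRing : CommutativeRing ℓ₁ ℓ₂
  ⊛-⊕-commutativeRing = record
    { Carrier = Series
    ; _≈_ = _≋_
    ; _+_ = _⊕_
    ; _*_ = _⊛_
    ; -_ = ⊖_
    ; 0# = 𝟘
    ; 1# = 𝟙
    ; isCommutativeRing = record
      { isRing = record
        { +-isAbelianGroup = record
          { isGroup = record
            { isMonoid = record
              { isSemigroup = record
                { isMagma = record
                  { isEquivalence = record
                    { refl = coefficientwise λ _ → refl
                    ; sym = λ p → coefficientwise λ n → sym (p .at n)
                    ; trans = λ p q → coefficientwise λ n → trans (p .at n) (q .at n)
                    }
                  ; ∙-cong = λ p q → coefficientwise λ n → +-cong (p .at n) (q .at n)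
                  }
                ; assoc = λ f g h → coefficientwise λ n → +-assoc _ _ _
                }
              ; identity = (λ f → coefficientwise λ n → +-identityˡ _) ,
                           (λ f → coefficientwise λ n → +-identityʳ _)
              }
            ; inverse = (λ f → coefficientwise λ n → -‿inverseˡ _) ,
                        (λ f → coefficientwise λ n → -‿inverseʳ _)
            ; ⁻¹-cong = λ p → coefficientwise λ n → -‿cong (p .at n)
            }
          ; comm = λ f g → coefficientwise λ n → +-comm _ _
          }
        ; *-cong = λ p q → coefficientwise (⊛-cong (p .at) (q .at))
        ; *-assoc = λ f g h → coefficientwise (⊛-assoc f g h)
        ; *-identity = (λ f → coefficientwise (𝟙-⊛ f)) ,
                       (λ f → coefficientwise λ n → trans (⊛-comm f 𝟙 n) (𝟙-⊛ f n))
        ; distrib = (λ f g h → coefficientwise λ n → trans (⊛-comm f (g ⊕ h) n)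
                      (trans (⊛-distribʳ f g h n) (+-cong (⊛-comm g f n) (⊛-comm h f n)))) ,
                    (λ f g h → coefficientwise (⊛-distribʳ f g h))
        }
      ; *-comm = λ f g → coefficientwise (⊛-comm f g)
      }
    }

-- Generating functions of partitions modulo 2

module PartitionSeries where

  open PowerSeries Bool.xor-∧-commutativeRing
  open CommutativeRing ⊛-⊕-commutativeRing hiding (zero)
  open import Algebra.Properties.CommutativeSemiring.Exp commutativeSemiring using (_^_)

  1+1≈0 : 1# + 1# ≈ 0#
  1+1≈0 .at zero = ≡.refl
  1+1≈0 .at (suc n) = ≡.refl

  open Characteristic2 ⊛-⊕-commutativeRing 1+1≈0
  open RogersSelberg ⊛-⊕-commutativeRing 1+1≈0 X

  X^-⊛ : ∀ m f n → (X ^ m * f) n ≡ (m ≤ᵇ n) ∧ f (n ∸ m)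
  X^-⊛ zero f n = 𝟙-⊛ f n
  X^-⊛ (suc m) f zero = ⊛-assoc X (X ^ m) f 0
  X^-⊛ (suc zero) f (suc n) = ≡.trans (⊛-assoc X 1# f (suc n)) (≡.trans (X-⊛-suc (1# * f) n) (𝟙-⊛ f n))
  X^-⊛ (suc (suc m)) f (suc n) = ≡.trans (⊛-assoc X (X ^ suc m) f (suc n))
    (≡.trans (X-⊛-suc (X ^ suc m * f) n) (X^-⊛ (suc m) f n))

  -- A generating function over 𝔽₂. The predicate is arbitrary because removing the largest part k
  -- replaces `P` by `P ∘ (k ∷_)`.
  Φ : ℕ → (List ℕ → Bool) → Series
  Φ m P n = ⨁ P (partsBounded n m n)

  Φ-expand : ∀ m P n → Φ m P (suc n) ≡
             ⨁ (λ k → (k <ᵇ m) ∧ Φ (suc k) (P ∘ (suc k ∷_)) (n ∸ k)) (upTo (suc n))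
  Φ-expand m P n = begin
    Φ m P (suc n)
      ≡⟨ ⨁-concatMap P _ (filter (λ k → suc k ≤? m) (upTo (suc n))) ⟩
    ⨁ (λ k → ⨁ P (List.map (suc k ∷_) (partsBounded n (suc k) (n ∸ k)))) (filter (λ k → suc k ≤? m) (upTo (suc n)))
      -- The fuel is cut from `n` to `n ∸ k`, as the coefficient of `Φ` at `n ∸ k` requires.
      ≡⟨ ⨁-cong (All.universal (λ k → ≡.trans (⨁-map P (suc k ∷_) (partsBounded n (suc k) (n ∸ k)))
           (≡.cong (⨁ (P ∘ (suc k ∷_))) (partsBounded-fuel n (n ∸ k) (suc k) (n ∸ k) (ℕ.m∸n≤m n k) ℕ.≤-refl)))
           (filter (λ k → suc k ≤? m) (upTo (suc n)))) ⟩
    ⨁ (λ k → Φ (suc k) (P ∘ (suc k ∷_)) (n ∸ k)) (filter (λ k → suc k ≤? m) (upTo (suc n)))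
      ≡⟨ ⨁-filter-≤ _ m (upTo (suc n)) ⟩
    ⨁ (λ k → (k <ᵇ m) ∧ Φ (suc k) (P ∘ (suc k ∷_)) (n ∸ k)) (upTo (suc n)) ∎
    where open ≡.≡-Reasoning

  -- A non-increasing list with parts at most m + 1 either has no part m + 1 or begins with one, and
  -- the rest keeps the same bound.
  Φ-suc : ∀ m P → Φ (suc m) P ≈ Φ m P + X ^ suc m * Φ (suc m) (P ∘ (suc m ∷_))
  Φ-suc m P .at n = ≡.trans (coefficient n)
    (≡.cong (Φ m P n xor_) (≡.sym (X^-⊛ (suc m) (Φ (suc m) (P ∘ (suc m ∷_))) n)))
    where
    coefficient : ∀ n → Φ (suc m) P n ≡ Φ m P n xor ((suc m ≤ᵇ n) ∧ Φ (suc m) (P ∘ (suc m ∷_)) (n ∸ suc m))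
    coefficient zero = ≡.sym (Bool.xor-comm (P [] xor false) false)
    coefficient (suc n) = ≡.trans (Φ-expand (suc m) P n) (≡.trans
      (⨁-below-suc (λ k → Φ (suc k) (P ∘ (suc k ∷_)) (n ∸ k)) m (suc n))
      (≡.cong (λ b → b xor ((m <ᵇ suc n) ∧ Φ (suc m) (P ∘ (suc m ∷_)) (n ∸ m))) (≡.sym (Φ-expand m P n))))

  Φ-cong : ∀ m {P P′} → (∀ {p} → PartsIn m p → P p ≡ P′ p) → Φ m P ≈ Φ m P′
  Φ-cong m P≡P′ .at n = ⨁-cong (All.map P≡P′ (partsBounded-PartsIn n m n))

  Φ-false : ∀ m → Φ m (λ _ → false) ≈ 0#
  Φ-false m .at n = ⨁-false (partsBounded n m n)

  -- Parts larger than n cannot occur in a partition of n. This lets the bound grow from n to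
  -- `top n`, where the products have been evaluated.
  Φ-bound : ∀ k n P → Φ (k ℕ.+ n) P n ≡ Φ n P n
  Φ-bound zero n P = ≡.refl
  Φ-bound (suc k) n P = ≡.trans (Φ-suc (k ℕ.+ n) P .at n) (≡.trans
    (≡.cong₂ _xor_ (Φ-bound k n P) (≡.trans (X^-⊛ (suc k ℕ.+ n) _ n)
      (≡.cong (λ b → b ∧ Φ (suc k ℕ.+ n) (P ∘ (suc (k ℕ.+ n) ∷_)) (n ∸ suc (k ℕ.+ n))) (dec-false (suc k ℕ.+ n ≤? n) (ℕ.m+n≮n k n)))))
    (Bool.xor-comm _ false))

  module _ (κ : ℕ → Multiplicity) where

    F : ℕ → Series
    F m = Φ m (respects κ m)

    -- The condition on the multiplicity of m + 1 is a parameter, since removing one copy of that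
    -- part turns `t` into `t ∘ suc`.
    G : ℕ → (ℕ → Bool) → Series
    G m t = Φ (suc m) (λ p → respects κ m p ∧ t (mult p (suc m)))

    G-suc : ∀ m t → G m t ≈ Φ m (λ p → respects κ m p ∧ t 0) + X ^ suc m * G m (t ∘ suc)
    G-suc m t = trans (Φ-suc m _) (+-cong
      (Φ-cong m (λ {p} ps → ≡.cong (λ i → respects κ m p ∧ t i) (mult-above ps (ℕ.n<1+n m))))
      (*-congˡ (Φ-cong (suc m) (λ {p} _ → ≡.cong₂ _∧_ (respects-∷ κ p (ℕ.n<1+n m))
        (≡.cong t (mult-∷-≡ (suc m) p))))))

    Φ-∧-true : ∀ m → Φ m (λ p → respects κ m p ∧ true) ≈ F m
    Φ-∧-true m = Φ-cong m (λ _ → Bool.∧-identityʳ _)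

    Φ-∧-false : ∀ m → Φ m (λ p → respects κ m p ∧ false) ≈ 0#
    Φ-∧-false m = trans (Φ-cong m (λ _ → Bool.∧-zeroʳ _)) (Φ-false m)

    G-false : ∀ m → G m (λ _ → false) ≈ 0#
    G-false m = trans (Φ-cong (suc m) (λ _ → Bool.∧-zeroʳ _)) (Φ-false (suc m))

    G-zero : ∀ m → G m (_≡ᵇ 0) ≈ F m
    G-zero m = trans (G-suc m (_≡ᵇ 0)) (trans (+-cong (Φ-∧-true m) (*-congˡ (G-false m)))
      (solve 2 (λ f k → f :+ k :* con false := f) refl (F m) (X ^ suc m)))

    F≈G : ∀ m {M} → κ (suc m) ≡ M → F (suc m) ≈ G m (allows M)
    F≈G m ≡.refl = refl

    G-once : ∀ m → G m (_≤ᵇ 1) ≈ F m + X ^ suc m * F m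
    G-once m = trans (G-suc m (_≤ᵇ 1)) (+-cong (Φ-∧-true m) (*-congˡ
      (trans (Φ-cong (suc m) (λ {p} _ → ≡.cong (respects κ m p ∧_) (<ᵇ1≡≡ᵇ0 (mult p (suc m))))) (G-zero m))))
      where
      <ᵇ1≡≡ᵇ0 : ∀ i → (i <ᵇ 1) ≡ (i ≡ᵇ 0)
      <ᵇ1≡≡ᵇ0 zero = ≡.refl
      <ᵇ1≡≡ᵇ0 (suc i) = ≡.refl

    G-skip : ∀ m t → t 0 ≡ false → G m t ≈ X ^ suc m * G m (t ∘ suc)
    G-skip m t t0≡false = trans (G-suc m t) (trans (+-congʳ (trans
      (Φ-cong m (λ {p} _ → ≡.cong (respects κ m p ∧_) t0≡false)) (Φ-∧-false m))) (+-identityˡ _))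

    F-absent : ∀ m → κ (suc m) ≡ absent → F (suc m) ≈ F m
    F-absent m eq = trans (F≈G m eq) (G-zero m)

    F-once : ∀ m → κ (suc m) ≡ once → F (suc m) ≈ F m + X ^ suc m * F m
    F-once m eq = trans (F≈G m eq) (G-once m)

    F-twice : ∀ m → κ (suc m) ≡ twice → F (suc m) ≈ X ^ suc m * (X ^ suc m * F m)
    F-twice m eq = trans (F≈G m eq) (trans (G-skip m (_≡ᵇ 2) ≡.refl)
      (*-congˡ (trans (G-skip m (_≡ᵇ 1) ≡.refl) (*-congˡ (G-zero m)))))

    F-free : ∀ m → κ (suc m) ≡ free → F (suc m) ≈ F m + X ^ suc m * F (suc m)
    F-free m eq = trans (F≈G m eq) (trans (G-suc m (λ _ → true))
      (+-cong (Φ-∧-true m) (*-congˡ (sym (F≈G m eq)))))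

  F-0 : ∀ κ → F κ 0 ≈ 1#
  F-0 κ .at zero = ≡.refl
  F-0 κ .at (suc n) = ≡.trans (Φ-expand 0 (λ _ → true) n) (⨁-false (upTo (suc n)))

  F-isProduct : ∀ κ → IsProduct κ (F κ)
  F-isProduct κ = record
    { F-0 = F-0 κ ; F-absent = F-absent κ ; F-once = F-once κ ; F-twice = F-twice κ ; F-free = F-free κ }

  truncate : ∀ f g h n → f ≈ g + X ^ suc n * h → f n ≡ g n
  truncate f g h n eq = ≡.trans (eq .at n) (≡.trans
    (≡.cong (g n xor_) (≡.trans (X^-⊛ (suc n) h n)
      (≡.cong (_∧ h (n ∸ suc n)) (dec-false (suc n ≤? n) (ℕ.n≮n n)))))
    (Bool.xor-comm (g n) false))

  ∑F≡∑θ : ∀ n → ∑ (suc n) (λ j → F (κ j) (top n)) n ≡ ∑ (suc n) (λ r → X ^ θ r + X ^ θ′ r) n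
  ∑F≡∑θ n = truncate (∑ (suc n) (λ j → F (κ j) (top n))) (∑ (suc n) (λ r → X ^ θ r + X ^ θ′ r))
    (proj₁ t) n (proj₂ t)
    where
    t = theta (λ j → F (κ j)) (λ j → F-isProduct (κ j)) X-cancel n

  X^-coefficient : ∀ m n → (X ^ m) n ≡ (m ≡ᵇ n)
  X^-coefficient zero zero = ≡.refl
  X^-coefficient zero (suc n) = ≡.refl
  X^-coefficient (suc m) zero = ≡.refl
  X^-coefficient (suc m) (suc n) = ≡.trans (X-⊛-suc (X ^ m) n) (X^-coefficient m n)

  ∑-coefficient : ∀ m f n → ∑ m f n ≡ ⨁ (λ j → f j n) (upTo m)
  ∑-coefficient zero f n = ≡.refl
  ∑-coefficient (suc m) f n = begin
    ∑ m f n xor f m n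
      ≡⟨ ≡.cong₂ _xor_ (∑-coefficient m f n) (≡.sym (Bool.xor-comm (f m n) false)) ⟩
    ⨁ (λ j → f j n) (upTo m) xor ⨁ (λ j → f j n) (m ∷ [])
      ≡⟨ ≡.sym (⨁-++ (λ j → f j n) (upTo m) (m ∷ [])) ⟩
    ⨁ (λ j → f j n) (upTo m ++ m ∷ [])
      ≡⟨ ≡.cong (⨁ (λ j → f j n)) (List.upTo-∷ʳ m) ⟩
    ⨁ (λ j → f j n) (upTo (suc m)) ∎
    where open ≡.≡-Reasoning

  -- The coefficient of q^n in the r-th summand of the theta series.
  hits : ℕ → ℕ → Bool
  hits n r = (θ r ≡ᵇ n) xor (θ′ r ≡ᵇ n)

  isOdd-c6 : ∀ n → isOdd (c6 n) ≡ ⨁ (hits n) (upTo (suc n))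
  isOdd-c6 n = begin
    isOdd (c6 n)
      ≡⟨ isOdd-filter P (partitions n) ⟩
    Φ n P n
      ≡⟨ ≡.sym (Φ-bound (top n ∸ n) n P) ⟩
    Φ (top n ∸ n ℕ.+ n) P n
      ≡⟨ ≡.cong (λ m → Φ m P n) (ℕ.m∸n+n≡m (ℕ.m≤n⇒m≤o+n 3 (ℕ.≤-trans (m≤m*2 n) (m≤m*2 (n ℕ.* 2))))) ⟩
    Φ (top n) P n
      ≡⟨ Φ-cong (top n) (condA∨condB≡⨁ n) .at n ⟩
    Φ (top n) (λ p → ⨁ (λ j → respects (κ j) (top n) p) (upTo (suc n))) n
      ≡⟨ ⨁-swap (λ p j → respects (κ j) (top n) p) (partsBounded n (top n) n) (upTo (suc n)) ⟩
    ⨁ (λ j → F (κ j) (top n) n) (upTo (suc n))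
      ≡⟨ ≡.sym (∑-coefficient (suc n) (λ j → F (κ j) (top n)) n) ⟩
    ∑ (suc n) (λ j → F (κ j) (top n)) n
      ≡⟨ ∑F≡∑θ n ⟩
    ∑ (suc n) (λ r → X ^ θ r ⊕ X ^ θ′ r) n
      ≡⟨ ∑-coefficient (suc n) (λ r → X ^ θ r ⊕ X ^ θ′ r) n ⟩
    ⨁ (λ r → (X ^ θ r) n xor (X ^ θ′ r) n) (upTo (suc n))
      ≡⟨ ⨁-cong (All.universal (λ r → ≡.cong₂ _xor_ (X^-coefficient (θ r) n) (X^-coefficient (θ′ r) n)) (upTo (suc n))) ⟩
    ⨁ (hits n) (upTo (suc n)) ∎
    where
    open ≡.≡-Reasoning
    P : List ℕ → Bool
    P p = condA p ∨ condB n p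

-- The exponents (7j² + 5j)/2

open PartitionSeries using (hits; isOdd-c6)
open import Data.Integer using (ℤ; +_; -[1+_]; _*_; _+_; _-_; -_; ∣_∣)
import Data.Integer.Properties as ℤ
import Data.Integer.Tactic.RingSolver as ℤ

7j²+5j : ℤ → ℤ
7j²+5j j = + 7 * (j * j) + + 5 * j

7j²+5j-factor : ∀ j k → 7j²+5j j - 7j²+5j k ≡ (j - k) * (+ 7 * (j + k) + + 5)
7j²+5j-factor = unfolded
  where
  unfolded : ∀ j k → + 7 * (j * j) + + 5 * j - (+ 7 * (k * k) + + 5 * k) ≡ (j - k) * (+ 7 * (j + k) + + 5)
  unfolded = ℤ.solve-∀

-- The second factor of the difference, 7(j+k) + 5, cannot vanish because 7 does not divide 5.
7j²+5j-injective : ∀ j k → 7j²+5j j ≡ 7j²+5j k → j ≡ k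
7j²+5j-injective j k eq with ℤ.i*j≡0⇒i≡0∨j≡0 (j - k) (≡.trans (≡.sym (7j²+5j-factor j k)) (ℤ.i≡j⇒i-j≡0 eq))
... | inj₁ j-k≡0 = ℤ.i-j≡0⇒i≡j j k j-k≡0
... | inj₂ 7m+5≡0 = contradiction (≡.trans (≡.sym (ℤ.abs-* (+ 7) (j + k))) (≡.cong ∣_∣ 7m≡-5)) (7m≢5 ∣ j + k ∣)
  where
  7m≡-5 : + 7 * (j + k) ≡ - (+ 5)
  7m≡-5 = ℤ.i-j≡0⇒i≡j (+ 7 * (j + k)) (- (+ 5)) 7m+5≡0
  7m≢5 : ∀ m → ¬ 7 ℕ.* m ≡ 5
  7m≢5 (suc m) eq with ≡.trans (≡.sym (ℕ.*-suc 7 m)) eq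
  ... | ()

2θ : ∀ r → + 2 * + θ r ≡ 7j²+5j (+ r)
2θ zero = ≡.refl
2θ (suc r) = begin
  + 2 * + (6 ℕ.+ (r ℕ.* 7 ℕ.+ θ r))
    ≡⟨ ≡.cong (λ i → + 2 * (+ 6 + i)) (≡.trans (ℤ.pos-+ (r ℕ.* 7) (θ r)) (≡.cong (_+ + θ r) (ℤ.pos-* r 7))) ⟩
  + 2 * (+ 6 + (+ r * + 7 + + θ r))
    ≡⟨ expand (+ r) (+ θ r) ⟩
  + 2 * + θ r + (+ 12 + + 14 * + r)
    ≡⟨ ≡.cong (_+ (+ 12 + + 14 * + r)) (2θ r) ⟩
  7j²+5j (+ r) + (+ 12 + + 14 * + r)
    ≡⟨ collect (+ r) ⟩
  7j²+5j (+ suc r) ∎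
  where
  open ≡.≡-Reasoning
  expand : ∀ r t → + 2 * (+ 6 + (r * + 7 + t)) ≡ + 2 * t + (+ 12 + + 14 * r)
  expand = ℤ.solve-∀
  collect : ∀ r → + 7 * (r * r) + + 5 * r + (+ 12 + + 14 * r) ≡ + 7 * ((+ 1 + r) * (+ 1 + r)) + + 5 * (+ 1 + r)
  collect = ℤ.solve-∀

2θ′ : ∀ r → + 2 * + θ′ r ≡ 7j²+5j -[1+ r ]
2θ′ r = begin
  + 2 * + (1 ℕ.+ (r ℕ.* 2 ℕ.+ θ r))
    ≡⟨ ≡.cong (λ i → + 2 * (+ 1 + i)) (≡.trans (ℤ.pos-+ (r ℕ.* 2) (θ r)) (≡.cong (_+ + θ r) (ℤ.pos-* r 2))) ⟩
  + 2 * (+ 1 + (+ r * + 2 + + θ r))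
    ≡⟨ expand (+ r) (+ θ r) ⟩
  + 2 * + θ r + (+ 2 + + 4 * + r)
    ≡⟨ ≡.cong (_+ (+ 2 + + 4 * + r)) (2θ r) ⟩
  7j²+5j (+ r) + (+ 2 + + 4 * + r)
    ≡⟨ collect (+ r) ⟩
  7j²+5j -[1+ r ] ∎
  where
  open ≡.≡-Reasoning
  expand : ∀ r t → + 2 * (+ 1 + (r * + 2 + t)) ≡ + 2 * t + (+ 2 + + 4 * r)
  expand = ℤ.solve-∀
  collect : ∀ r → + 7 * (r * r) + + 5 * r + (+ 2 + + 4 * r) ≡ + 7 * (- (+ 1 + r) * - (+ 1 + r)) + + 5 * - (+ 1 + r)
  collect = ℤ.solve-∀

r≤θ : ∀ r → r ≤ θ r
r≤θ zero = z≤n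
r≤θ (suc r) = s≤s (ℕ.≤-trans (r≤θ r) (ℕ.m≤n⇒m≤o+n 5 (ℕ.m≤n+m (θ r) (r ℕ.* 7))))

r≤θ′ : ∀ r → r ≤ θ′ r
r≤θ′ r = ℕ.m≤n⇒m≤1+n (ℕ.≤-trans (r≤θ r) (ℕ.m≤n+m (θ r) (r ℕ.* 2)))

θℤ : ℤ → ℕ
θℤ (+ r) = θ r
θℤ -[1+ r ] = θ′ r

2θℤ : ∀ j → + 2 * + θℤ j ≡ 7j²+5j j
2θℤ (+ r) = 2θ r
2θℤ -[1+ r ] = 2θ′ r

θℤ-injective : ∀ {j k} → θℤ j ≡ θℤ k → j ≡ k
θℤ-injective {j} {k} eq = 7j²+5j-injective j k
  (≡.trans (≡.sym (2θℤ j)) (≡.trans (≡.cong (λ n → + 2 * + n) eq) (2θℤ k)))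

θℤ-unique : ∀ {n} j → + 2 * + n ≡ 7j²+5j j → θℤ j ≡ n
θℤ-unique j eq = ℤ.+-injective (ℤ.*-cancelˡ-≡ (+ 2) _ _ (≡.trans (2θℤ j) (≡.sym eq)))

-- The r for which j contributes to the summand X ^ θ r + X ^ θ′ r.
index : ℤ → ℕ
index (+ r) = r
index -[1+ r ] = r

-- Ensures that the theta series truncated at r ≤ n still contains every exponent equal to n.
index≤θℤ : ∀ j → index j ≤ θℤ j
index≤θℤ (+ r) = r≤θ r
index≤θℤ -[1+ r ] = r≤θ′ r

-- The other exponent of the pair belongs to a different integer, so by injectivity it cannot cancel
-- this one.
hits⁺ : ∀ j → T (hits (θℤ j) (index j))
hits⁺ (+ r) = from Bool.T-≡ (≡.cong₂ _xor_ (dec-true (θ r ℕ.≟ θ r) ≡.refl)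
  (dec-false (θ′ r ℕ.≟ θ r) (λ eq → contradiction (θℤ-injective { -[1+ r ] } {+ r} eq) λ ())))
hits⁺ -[1+ r ] = from Bool.T-≡ (≡.cong₂ _xor_
  (dec-false (θ r ℕ.≟ θ′ r) (λ eq → contradiction (θℤ-injective {+ r} { -[1+ r ] } eq) λ ()))
  (dec-true (θ′ r ℕ.≟ θ′ r) ≡.refl))

hits⁻ : ∀ {n r} → T (hits n r) → ∃ λ j → θℤ j ≡ n × index j ≡ r
hits⁻ {n} {r} h with θ r ℕ.≟ n | θ′ r ℕ.≟ n
... | yes eq | _ = + r , eq , ≡.refl
... | no _ | yes eq = -[1+ r ] , eq , ≡.refl
... | no θ≢n | no θ′≢n rewrite dec-false (θ r ℕ.≟ n) θ≢n | dec-false (θ′ r ℕ.≟ n) θ′≢n = contradiction h id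

hits-unique : ∀ {n r s} → T (hits n r) → T (hits n s) → r ≡ s
hits-unique hr hs =
  let j , θj≡n , j≡r = hits⁻ hr
      k , θk≡n , k≡s = hits⁻ hs
  in ≡.trans (≡.sym j≡r) (≡.trans (≡.cong index (θℤ-injective {j} {k} (≡.trans θj≡n (≡.sym θk≡n)))) k≡s)

c6%2 : ∀ n → c6 n % 2 ≡ bit (⨁ (hits n) (upTo (suc n)))
c6%2 n = ≡.trans (%2≡bit-isOdd (c6 n)) (≡.cong bit (isOdd-c6 n))

-- Only one `r` can hit this exponent, so the parity reduces to existence, witnessed by `index j`.
c6-odd : ∀ j → c6 (θℤ j) % 2 ≡ 1
c6-odd j = ≡.trans (c6%2 n) (≡.cong bit (≡.trans
  (≡.sym (any≡⨁ (hits n) (suc n) (λ _ _ → hits-unique {n})))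
  (to Bool.T-≡ (Any.any⁺ (hits n) (lose (∈-upTo⁺ (s≤s (index≤θℤ j))) (hits⁺ j))))))
  where
  n : ℕ
  n = θℤ j

theorem7 : (n : ℕ) →
    ((∃ λ (j : ℤ) → + 2 * + n ≡ + 7 * (j * j) + + 5 * j) → c6 n % 2 ≡ 1)
    Data.Product.× ((¬ (∃ λ (j : ℤ) → + 2 * + n ≡ + 7 * (j * j) + + 5 * j)) → c6 n % 2 ≡ 0)
theorem7 n =
  (λ (j , eq) → ≡.subst (λ n → c6 n % 2 ≡ 1) (θℤ-unique {n} j eq) (c6-odd j)) ,
  (λ ¬∃j → ≡.trans (c6%2 n) (≡.cong bit (⨁-none (hits n) (suc n) λ {r} _ → Bool.¬-not λ hits≡true →
    let j , θj≡n , _ = hits⁻ {n} {r} (from Bool.T-≡ hits≡true)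
    in ¬∃j (j , ≡.subst (λ n → + 2 * + n ≡ 7j²+5j j) θj≡n (2θℤ j)))))
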